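{- Consider an instance of the weighted popular matching problem, with ties allowed in the preference lists, in which every applicant has a last resort job. Suppose the procedure PRUNE-TIES (described in the context), run on the graph $G$ of first-job and second-job edges, does not return "no popular matching exists", and let $G'$ be the resulting pruned graph. Then a matching $M$ is popular if and only if $M$ is well-formed and $M\subseteq G'$.
   Context: Instance. A finite bipartite graph $H=(A,J,E)$ between applicants $A$ and jobs $J$; each edge $(x,p)$ has a rank $r_x(p)\in\mathbb{Z}^+$; each applicant $x$ has a weight $w(x)>0$. The jobs adjacent to $x$ form $x$'s preference list (not necessarily containing all jobs). Applicant $x$ prefers $p$ over $q$ if $r_x(p)<r_x(q)$ ("$p$ is ranked higher") and is indifferent if $r_x(p)=r_x(q)$. Every applicant $x$ has a last resort job $l(x)$, which is on the list of no other applicant and is strictly worse for $x$ than every other job on $x$'s list. Being unmatched is worse for $x$ than receiving any job on $x$'s list. Popularity. The satisfaction of a matching $M_1$ with respect to $M_2$ is the total weight of applicants who prefer (the job they get in) $M_1$ over $M_2$ minus the total weight of those who prefer $M_2$ over $M_1$. $M_1$ is more popular than $M_2$ if this is positive. $M$ is popular if no matching of $H$ is more popular than $M$. Categories. $A$ is partitioned into nonempty sets $C_1,\dots,C_k$, where applicants in $C_i$ have weight $w_i$ and $w_1>w_2>\dots>w_k>0$. First jobs, graphs $G_i$, second jobs. A vertex (job or applicant) is critical in a graph $G_i$ if it is matched in every maximum cardinality matching of $G_i$, and non-critical otherwise. For $x\in C_1$, $f(x)$ is the set of highest ranked jobs on $x$'s list; $G_1$ is the graph with the edges between applicants $x\in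 C_1$ and the jobs in $f(x)$. Inductively for $i>1$ and $x\in C_i$, $f(x)$ is the set of highest ranked jobs among those on $x$'s list that are non-critical in all of $G_1,\dots,G_{i-1}$; $G_i$ consists of $G_{i-1}$ together with all edges between applicants $x\in C_i$ and the jobs in $f(x)$. (All $G_i$ may be taken on vertex set $A\cup J$.) For $x\in C_i$: if $x$ is non-critical in $G_i$, $s(x)$ is the set of highest ranked jobs among those on $x$'s list that are non-critical in all of $G_1,\dots,G_i$; if $x$ is critical in $G_i$, $s(x)=\emptyset$. Well-formed. A matching $M$ is well-formed if for all $1\le i\le k$ the matching $M\cap E[G_i]$ is a maximum matching of $G_i$, and every applicant $x$ is matched to a job in $f(x)\cup s(x)$. The graph $G$ consists of all edges $(x,p)$ with $x\in A$, $p\in f(x)\cup s(x)$. PRUNE-TIES($G$) computes labels $\lambda(p)$ for jobs critical in some $G_i$ and deletes ("prunes") edges of $G$; the graphs $G_i$ and the notion of criticality always refer to the unpruned graphs. Here $\lambda_{\min}(x,f(x))$ (resp. $\lambda_{\min}(x,s(x))$) is $\min_q\lambda(q)$ over jobs $q$ that $x$ strictly prefers to the jobs in $f(x)$ (resp. $s(x)$), and $\lambda_{\mathrm{equiv}}(x)$ is $\min_q\lambda(q)$ over jobs $q\notin f(x)$ on $x$'s list having the same rank for $x$ as the jobs in $f(x)$; a minimum over the empty set is $\infty$. 1. Set $\lambda(p)=w_1$ for all jobs $p$ critical in $G_1$. 2. For $i=2,\dots,k$: (a) if some $x\in C_i$ has $\lambda_{\min}(x,f(x))<w_i$, return "no popular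 matching exists" and stop; (b) for every $j\le i$ and $x\in C_j$ that is non-critical in $G_i$: if $\lambda_{\min}(x,f(x))<w_j+w_i$ or $\lambda_{\mathrm{equiv}}(x)<w_i$, prune all edges between $x$ and $f(x)$; (c) for every job $p$ critical in $G_i$ but non-critical in all of $G_1,\dots,G_{i-1}$: fix an arbitrary maximum matching $M_i$ of $G_i$, let $S$ be the set of applicants $x$, critical in $G_i$, for which there is a simple path in $G_i$ from $p$ to $x$ that alternates between edges in $M_i$ and edges not in $M_i$ and whose first and last edges are in $M_i$; set $\lambda(p)$ to be the minimum of $w_i$ and of the quantities $\lambda_{\min}(x,f(x))-w(x)$ and $\lambda_{\mathrm{equiv}}(x)$ over $x\in S$. 3. For every $x\in A$ with $s(x)\neq\emptyset$ and $\lambda_{\min}(x,s(x))<w(x)$, prune all edges between $x$ and $s(x)$. The graph remaining at the end is the pruned graph $G'$. -}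

module Defs where

open import Algebra.Bundles using (AbelianGroup)
open import Algebra.Core using (Op₁; Op₂)
open import Algebra.Structures using (IsAbelianGroup)
open import Data.Bool.Base using (if_then_else_)
open import Data.Empty using (⊥)
open import Data.Fin.Base as Fin using (Fin; toℕ)
open import Data.Fin.Subset using (Subset; _∈_; ∣_∣)
open import Data.List.Base using (List; []; _∷_)
open import Data.List.Relation.Unary.Unique.Propositional using (Unique)
open import Data.Maybe.Base as Maybe using (Maybe; just; nothing; is-just)
open import Data.Nat.Base as ℕ using (ℕ; zero; suc)
open import Data.Product.Base using (_×_; _,_; ∃; ∃-syntax; Σ-syntax)
open import Data.Sum.Base using (_⊎_; inj₁; inj₂)
open import Data.Unit.Base using (⊤; tt)
open import Data.Vec.Base using (tabulate)
open import Function.Base using (_∘_)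
open import Level using (Level; 0ℓ; _⊔_) renaming (suc to lsuc)
open import Relation.Binary.Construct.Intersection using (_∩_)
open import Relation.Binary.Core using (Rel; REL; _⇒_; _⇔_)
open import Relation.Binary.PropositionalEquality.Core using (_≡_; _≢_)
open import Relation.Binary.Structures using (IsStrictTotalOrder)
open import Relation.Nullary.Construct.Add.Supremum using (_⁺; [_]; ⊤⁺)
open import Relation.Nullary.Decidable.Core using (Dec; yes; no; does)
open import Relation.Nullary.Negation.Core using (¬_)
open import Relation.Unary using (Pred)

import Algebra.Properties.Monoid.Sum as Sum
import Data.Nat.Properties as ℕ
import Relation.Binary.Construct.Add.Supremum.Strict as Supremum

-- Weights are only ever added, subtracted and compared, so they are taken in an
-- arbitrary totally ordered abelian group (ℤ, ℚ and, classically, ℝ).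
record OrderedAbelianGroup c ℓ₁ ℓ₂ : Set (lsuc (c ⊔ ℓ₁ ⊔ ℓ₂)) where
  infix  8 -_
  infixl 6 _+_ _-_
  infix  4 _≈_ _<_
  field
    Carrier            : Set c
    _≈_                : Rel Carrier ℓ₁
    _<_                : Rel Carrier ℓ₂
    _+_                : Op₂ Carrier
    0#                 : Carrier
    -_                 : Op₁ Carrier
    isAbelianGroup     : IsAbelianGroup _≈_ _+_ 0# -_
    isStrictTotalOrder : IsStrictTotalOrder _≈_ _<_
    +-monoʳ-<          : ∀ z {x y} → x < y → z + x < z + y

  _-_ : Op₂ Carrier
  x - y = x + - y

  abelianGroup : AbelianGroup c ℓ₁
  abelianGroup = record { isAbelianGroup = isAbelianGroup }

  open AbelianGroup abelianGroup public using (monoid)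

record Instance {c ℓ₁ ℓ₂} (W : OrderedAbelianGroup c ℓ₁ ℓ₂) : Set (c ⊔ ℓ₂) where
  open OrderedAbelianGroup W
  field
    #applicants #jobs #categories : ℕ

  Applicant = Fin #applicants
  Job       = Fin #jobs
  Category  = Fin #categories

  field
    list      : Applicant → Subset #jobs
    -- Only the values `rank x p` with `p ∈ list x` matter.
    rank      : Applicant → Job → ℕ
    rank-pos  : ∀ x p → p ∈ list x → 0 ℕ.< rank x p

    lastResort        : Applicant → Job
    lastResort-listed : ∀ x → lastResort x ∈ list x
    lastResort-own    : ∀ x y → lastResort x ∈ list y → y ≡ x
    lastResort-worst  : ∀ x p → p ∈ list x → p ≢ lastResort x →
                        rank x p ℕ.< rank x (lastResort x)

    -- Categories are numbered from 0: `category x ≡ i` means x ∈ C_{i+1}, and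
    -- `weight i` is w_{i+1}.
    category          : Applicant → Category
    category-nonempty : ∀ i → ∃[ x ] category x ≡ i
    weight            : Category → Carrier
    weight-pos        : ∀ i → 0# < weight i
    weight-decreasing : ∀ i j → i Fin.< j → weight j < weight i

  w : Applicant → Carrier
  w x = weight (category x)

module PopularMatching {c ℓ₁ ℓ₂} {W : OrderedAbelianGroup c ℓ₁ ℓ₂}
                       (I : Instance W) where

  open OrderedAbelianGroup W
  open Instance I
  open Sum monoid using (sum)
  open Supremum _<_ using (_<⁺_)

  Graph : (ℓ : Level) → Set (lsuc ℓ)
  Graph ℓ = REL Applicant Job ℓ

  record Matching : Set where
    field
      mate      : Applicant → Maybe Job
      listed    : ∀ x p → mate x ≡ just p → p ∈ list x
      injective : ∀ x y p → mate x ≡ just p → mate y ≡ just p → x ≡ y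

  open Matching public

  edges : Matching → Graph 0ℓ
  edges M x p = mate M x ≡ just p

  size : Matching → ℕ
  size M = ∣ tabulate (is-just ∘ mate M) ∣

  -- `nothing` is being unmatched.
  Prefers : Applicant → Maybe Job → Maybe Job → Set
  Prefers x (just p) (just q) = rank x p ℕ.< rank x q
  Prefers x (just p) nothing  = ⊤
  Prefers x nothing  _        = ⊥

  prefers? : ∀ x a b → Dec (Prefers x a b)
  prefers? x (just p) (just q) = rank x p ℕ.<? rank x q
  prefers? x (just p) nothing  = yes tt
  prefers? x nothing  _        = no λ ()

  preferenceWeight : Matching → Matching → Carrier
  preferenceWeight M N =
    sum λ x → if does (prefers? x (mate M x) (mate N x)) then w x else 0#

  satisfaction : Matching → Matching → Carrier
  satisfaction M N = preferenceWeight M N - preferenceWeight N M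

  MorePopular : Matching → Matching → Set ℓ₂
  MorePopular M N = 0# < satisfaction M N

  Popular : Matching → Set ℓ₂
  Popular M = ¬ (∃[ N ] MorePopular N M)

  IsMaximum : Graph 0ℓ → Matching → Set
  IsMaximum H M = (edges M ⇒ H) × (∀ N → edges N ⇒ H → size N ℕ.≤ size M)

  Vertex : Set
  Vertex = Applicant ⊎ Job

  Matched : Matching → Vertex → Set
  Matched M (inj₁ x) = ∃[ p ] edges M x p
  Matched M (inj₂ p) = ∃[ x ] edges M x p

  Critical : Graph 0ℓ → Vertex → Set
  Critical H v = ∀ M → IsMaximum H M → Matched M v

  Highest : Pred Job 0ℓ → Applicant → Pred Job 0ℓ
  Highest P x p = p ∈ list x × P p ×
                  (∀ q → q ∈ list x → P q → rank x p ℕ.≤ rank x q)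

  -- G i is G_i, with G 0 the edgeless graph; NonCriticalUpTo i holds of the jobs
  -- that are non-critical in all of G_1, …, G_i.
  mutual
    G : ℕ → Graph 0ℓ
    G zero    x p = ⊥
    G (suc i) x p = G i x p ⊎
                    (toℕ (category x) ≡ i × Highest (NonCriticalUpTo i) x p)

    NonCriticalUpTo : ℕ → Pred Job 0ℓ
    NonCriticalUpTo zero    p = ⊤
    NonCriticalUpTo (suc i) p = NonCriticalUpTo i p × ¬ Critical (G (suc i)) (inj₂ p)

  -- The graph G_{i+1} belonging to the category numbered i.
  Gᶜ : Category → Graph 0ℓ
  Gᶜ i = G (suc (toℕ i))

  First : Applicant → Pred Job 0ℓ
  First x = Highest (NonCriticalUpTo (toℕ (category x))) x

  Second : Applicant → Pred Job 0ℓ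
  Second x p = ¬ Critical (Gᶜ (category x)) (inj₁ x) ×
               Highest (NonCriticalUpTo (suc (toℕ (category x)))) x p

  -- N is the matching M ∩ E[G_i].
  WellFormed : Matching → Set
  WellFormed M =
    (∀ i → Σ[ N ∈ Matching ] (edges N ⇔ (edges M ∩ Gᶜ i)) × IsMaximum (Gᶜ i) N) ×
    (∀ x → ∃[ p ] edges M x p × (First x p ⊎ Second x p))

  -- v is the minimum of the set T of weights in Carrier ∪ {∞}, where ∞ = ⊤⁺.
  IsMin : ∀ {ℓ} → Pred (Carrier ⁺) ℓ → Carrier ⁺ → Set (c ⊔ ℓ₂ ⊔ ℓ)
  IsMin T v = (∀ u → T u → ¬ (u <⁺ v)) × (T v ⊎ v ≡ ⊤⁺)

  -- A job without a label is given the label ⊤⁺, which leaves minima unchanged.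
  Labelling : Set c
  Labelling = Job → Carrier ⁺

  -- v = λ_min(x, X), v = λ_equiv(x)
  IsLambdaMin : Labelling → Applicant → Pred Job 0ℓ → Carrier ⁺ → Set (c ⊔ ℓ₂)
  IsLambdaMin l x X = IsMin λ u →
    ∃[ q ] q ∈ list x × (∀ p → X p → rank x q ℕ.< rank x p) × u ≡ l q

  IsLambdaEquiv : Labelling → Applicant → Carrier ⁺ → Set (c ⊔ ℓ₂)
  IsLambdaEquiv l x = IsMin λ u →
    ∃[ q ] q ∈ list x × ¬ First x q × (∀ p → First x p → rank x q ≡ rank x p) × u ≡ l q

  -- "the value described by P is less than b"
  _Below_ : Pred (Carrier ⁺) (c ⊔ ℓ₂) → Carrier → Set (c ⊔ ℓ₂)
  P Below b = ∃[ v ] P v × v <⁺ [ b ]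

  -- Paths p, x, p′, x′, …, ending at z, that alternate between edges in M and
  -- edges of H not in M, starting and ending with an edge in M; they are indexed
  -- by the lists of jobs and of applicants they visit.
  data AltPath (H : Graph 0ℓ) (M : Matching) (z : Applicant) :
               Job → List Job → List Applicant → Set where
    end  : ∀ {p} → H z p → edges M z p → AltPath H M z p (p ∷ []) (z ∷ [])
    step : ∀ {p x p′ ps xs} →
           H x p → edges M x p → H x p′ → ¬ edges M x p′ →
           AltPath H M z p′ ps xs → AltPath H M z p (p ∷ ps) (x ∷ xs)

  SimpleAltPath : Graph 0ℓ → Matching → Job → Applicant → Set
  SimpleAltPath H M p x = ∃[ ps ] ∃[ xs ] AltPath H M x p ps xs × Unique ps × Unique xs

  -- The weights whose minimum becomes the label of p.
  data Candidate (l : Labelling) (i : Category) (M : Matching) (p : Job) :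
                 Pred (Carrier ⁺) (c ⊔ ℓ₂) where
    own   : Candidate l i M p [ weight i ]
    min   : ∀ {x v} → Critical (Gᶜ i) (inj₁ x) → SimpleAltPath (Gᶜ i) M p x →
            IsLambdaMin l x (First x) v → Candidate l i M p (Maybe.map (_- w x) v)
    equiv : ∀ {x v} → Critical (Gᶜ i) (inj₁ x) → SimpleAltPath (Gᶜ i) M p x →
            IsLambdaEquiv l x v → Candidate l i M p v

  NewlyCritical : Category → Pred Job 0ℓ
  NewlyCritical i p = NonCriticalUpTo (toℕ i) p × Critical (Gᶜ i) (inj₂ p)

  -- A run of PRUNE-TIES, for arbitrary choices of the maximum matchings. `labels i`
  -- is the labelling after the iteration for G_i, so that the iteration for
  -- category i starts from `labels (toℕ i)`.
  record Run : Set (c ⊔ ℓ₂) where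
    field
      chosen         : Category → Job → Matching
      chosen-maximum : ∀ i p → IsMaximum (Gᶜ i) (chosen i p)
      labels         : ℕ → Labelling
      labels-start   : ∀ p → labels 0 p ≡ ⊤⁺
      labels-keep    : ∀ i p → ¬ NewlyCritical i p →
                       labels (suc (toℕ i)) p ≡ labels (toℕ i) p
      labels-first   : ∀ i p → toℕ i ≡ 0 → NewlyCritical i p →
                       labels (suc (toℕ i)) p ≡ [ weight i ]
      labels-later   : ∀ i p → 0 ℕ.< toℕ i → NewlyCritical i p →
                       IsMin (Candidate (labels (toℕ i)) i (chosen i p) p)
                             (labels (suc (toℕ i)) p)

  module _ (r : Run) where
    open Run r

    -- A `Run` does not stop at such an answer; its later labels are then
    -- meaningless.
    ReturnsNoPopularMatching : Set (c ⊔ ℓ₂)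
    ReturnsNoPopularMatching = ∃[ i ] ∃[ x ]
      0 ℕ.< toℕ i × category x ≡ i ×
      (IsLambdaMin (labels (toℕ i)) x (First x) Below weight i)

    data Pruned : Graph (c ⊔ ℓ₂) where
      first  : ∀ {x p} i → 0 ℕ.< toℕ i → category x Fin.≤ i →
               ¬ Critical (Gᶜ i) (inj₁ x) →
               (IsLambdaMin (labels (toℕ i)) x (First x) Below (w x + weight i)) ⊎
               (IsLambdaEquiv (labels (toℕ i)) x Below weight i) →
               First x p → Pruned x p
      second : ∀ {x p} →
               IsLambdaMin (labels #categories) x (Second x) Below w x →
               Second x p → Pruned x p

    PrunedGraph : Graph (c ⊔ ℓ₂)
    PrunedGraph x p = (First x p ⊎ Second x p) × ¬ Pruned x p

{-# OPTIONS --safe #-}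

-- Weigh every edge by the vote of its applicant against M. By duality for the
-- assignment problem M is popular iff jobs can be given prices β ≥ 0, zero on unmatched
-- jobs, such that moving any applicant x to any listed job q never costs less than the
-- vote it wins:  β(M(x)) + vote(x, q) ≤ β(q).  If M is well-formed and inside G′, the
-- labels λ (zero on unlabelled jobs) are such prices. Conversely the prices of a popular
-- M satisfy β ≤ λ, and the price conditions then give well-formedness and rule out
-- pruned edges. Criticality is accessible because the same duality, applied to
-- cardinality, yields König vertex covers: a job is critical iff some minimum cover
-- contains it, a matched applicant iff some minimum cover avoids her mate. Sets such as
-- {p ∣ β(p) ≥ w_i} are covers of G_i, and a cover for one maximum matching is one for all,
-- so no two maximum matchings ever have to be compared along alternating paths.
module Submission where

open import Algebra.Bundles using (AbelianGroup)
open import Data.Bool.Base using (if_then_else_)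
open import Data.Fin.Base using (Fin; zero; suc; toℕ; fromℕ<; finToFun; funToFin)
open import Data.Fin.Properties using (_≟_; any?; all?; finToFun-funToFin; toℕ-fromℕ<; toℕ<n; toℕ-injective)
open import Data.Fin.Subset using (_∈_; ∣_∣)
open import Data.Fin.Subset.Properties using (_∈?_)
open import Data.Integer.Base as ℤ using (ℤ; +_; +<+)
open import Data.Integer.Tactic.RingSolver using (solve-∀)
open import Data.List.Base using (List; []; _∷_; _++_)
open import Data.List.Membership.DecPropositional using () renaming (_∈?_ to mem?)
open import Data.List.Membership.Propositional using () renaming (_∈_ to _∈ˡ_; _∉_ to _∉ˡ_)
open import Data.List.Membership.Propositional.Properties using (∈-++⁺ʳ; ∈-++⁻)
open import Data.List.Properties using (∷-injectiveʳ)
open import Data.List.Relation.Unary.All.Properties using (¬Any⇒All¬)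
open import Data.List.Relation.Unary.AllPairs using ([]; _∷_)
open import Data.List.Relation.Unary.Any using (here; there)
open import Data.List.Relation.Unary.Unique.Propositional using (Unique)
open import Data.List.Relation.Unary.Unique.Propositional.Properties using (Unique[x∷xs]⇒x∉xs)
  renaming (++⁺ to Unique-++⁺)
open import Data.Maybe.Base using (Maybe; just; nothing; maybe′; is-just)
open import Data.Maybe.Properties using (just-injective; ≡-dec)
open import Data.Nat.Base as ℕ using (ℕ; s≤s; z≤n)
open import Data.Product.Base using (_×_; _,_; proj₁; proj₂; ∃; ∃-syntax; Σ-syntax)
open import Data.Sum.Base using (_⊎_; inj₁; inj₂; [_,_]′)
open import Data.Unit.Base using (⊤; tt)
open import Data.Vec.Base using (tabulate)
open import Data.Vec.Properties using (tabulate-cong)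
open import Function.Base using (_∘_; id)
open import Function.Bundles using (_⇔_; mk⇔)
open import Induction.WellFounded using (Acc; acc)
open import Level using (_⊔_; Lift; lift; 0ℓ)
open import Relation.Binary.Construct.Intersection using (_∩_)
open import Relation.Binary.Core using (Rel; _⇒_) renaming (_⇔_ to _⇔ᵍ_)
open import Relation.Binary.Definitions using (DecidableEquality; tri<; tri≈; tri>)
open import Relation.Binary.PropositionalEquality.Core as ≡ using (_≡_; _≢_; _≗_)
open import Relation.Binary.PropositionalEquality.Properties using (module ≡-Reasoning)
open import Relation.Binary.Structures using (IsPreorder; IsStrictTotalOrder)
open import Relation.Nullary.Construct.Add.Supremum using (_⁺; [_]; ⊤⁺)
open import Relation.Nullary.Decidable
  using (map′; _×-dec_; _⊎-dec_; _→-dec_; ¬?; decidable-stable; dec-true; dec-false; ¬¬-excluded-middle)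
open import Relation.Nullary.Decidable.Core using (Dec; yes; no; does)
open import Relation.Nullary.Negation.Core using (¬_; contradiction)
open import Relation.Unary using (Pred; Decidable)
open import Defs

import Algebra.Properties.CommutativeMonoid.Sum as CommutativeSum
import Data.Integer.Properties as ℤ
import Data.List.Relation.Unary.All as All
import Data.List.Relation.Unary.All.Properties as All
import Data.Nat.Induction as ℕ
import Data.Nat.Properties as ℕ
import Relation.Binary.Construct.Add.Supremum.Strict as Supremum
import Relation.Binary.Reasoning.Base.Triple as Triple

-- Ordered abelian groups

-- The bound β ≤ λ holds because each quantity in the minimum defining λ(p) is an upper bound that
-- the price conditions force on β(p), via an alternating path from p. Two obstacles shape the
-- argument. The run picks its own maximum matchings, which need not agree with M, so a path in one
-- of them has to be read in M; covers do this, since membership travels along a path and survives a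
-- change of matching. And the price condition between two first jobs p, q of one applicant is no
-- rule of the labelling: if p became critical later than q, the applicant y that limits the label
-- of q either limits that of p as well, or has become non-critical in the meantime, and then the
-- fact that her edge escaped pruning gives the bound. Paths are only ever shown to exist up to
-- double negation.

module OrderedGroup {c ℓ₁ ℓ₂} (W : OrderedAbelianGroup c ℓ₁ ℓ₂) where
  open OrderedAbelianGroup W
  open AbelianGroup abelianGroup public
    using (commutativeMonoid; setoid; isEquivalence; refl; sym; trans; reflexive)
    renaming (∙-cong to +-cong; ∙-congˡ to +-congˡ; ∙-congʳ to +-congʳ; assoc to +-assoc;
              comm to +-comm; identityˡ to +-identityˡ; identityʳ to +-identityʳ;
              inverseˡ to +-inverseˡ; inverseʳ to +-inverseʳ)
  open IsStrictTotalOrder isStrictTotalOrder public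
    using (compare; _<?_; <-resp-≈; <-respʳ-≈; <-respˡ-≈)
    renaming (irrefl to <-irrefl; asym to <-asym; trans to <-trans)
  open CommutativeSum commutativeMonoid public

  infix 4 _≤_
  -- Being a negation, `x ≤ y` follows from a doubly negated premise; this is how the paths of
  -- `reaches-own` and `reaches-chain` are put to use.
  _≤_ : Rel Carrier ℓ₂
  x ≤ y = ¬ (y < x)

  ≤-reflexive : ∀ {x y} → x ≈ y → x ≤ y
  ≤-reflexive x≈y = <-irrefl (sym x≈y)

  ≤-refl : ∀ {x} → x ≤ x
  ≤-refl = ≤-reflexive refl

  <⇒≤ : ∀ {x y} → x < y → x ≤ y
  <⇒≤ = <-asym

  <-≤-trans : ∀ {x y z} → x < y → y ≤ z → x < z
  <-≤-trans {x} {y} {z} x<y y≤z with compare x z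
  ... | tri< x<z _ _ = x<z
  ... | tri≈ _ x≈z _ = contradiction (<-respˡ-≈ x≈z x<y) y≤z
  ... | tri> _ _ z<x = contradiction (<-trans z<x x<y) y≤z

  ≤-<-trans : ∀ {x y z} → x ≤ y → y < z → x < z
  ≤-<-trans {x} {y} {z} x≤y y<z with compare x z
  ... | tri< x<z _ _ = x<z
  ... | tri≈ _ x≈z _ = contradiction (<-respʳ-≈ (sym x≈z) y<z) x≤y
  ... | tri> _ _ z<x = contradiction (<-trans y<z z<x) x≤y

  ≤-trans : ∀ {x y z} → x ≤ y → y ≤ z → x ≤ z
  ≤-trans x≤y y≤z z<x = y≤z (<-≤-trans z<x x≤y)

  ≤-antisym : ∀ {x y} → x ≤ y → y ≤ x → x ≈ y
  ≤-antisym {x} {y} x≤y y≤x with compare x y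
  ... | tri< x<y _ _ = contradiction x<y y≤x
  ... | tri≈ _ x≈y _ = x≈y
  ... | tri> _ _ y<x = contradiction y<x x≤y

  ≤-total : ∀ x y → x ≤ y ⊎ y ≤ x
  ≤-total x y with compare x y
  ... | tri< x<y _ _ = inj₁ (<⇒≤ x<y)
  ... | tri≈ _ x≈y _ = inj₁ (≤-reflexive x≈y)
  ... | tri> _ _ y<x = inj₂ (<⇒≤ y<x)

  ≤-isPreorder : IsPreorder _≈_ _≤_
  ≤-isPreorder = record { isEquivalence = isEquivalence ; reflexive = ≤-reflexive ; trans = ≤-trans }

  module ≤-Reasoning = Triple ≤-isPreorder
    <-asym <-trans <-resp-≈ <⇒≤ <-≤-trans ≤-<-trans

  +-monoˡ-< : ∀ z {x y} → x < y → x + z < y + z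
  +-monoˡ-< z x<y = <-respˡ-≈ (+-comm z _) (<-respʳ-≈ (+-comm z _) (+-monoʳ-< z x<y))

  +-monoʳ-≤ : ∀ z {x y} → x ≤ y → z + x ≤ z + y
  +-monoʳ-≤ z {x} {y} x≤y with compare x y
  ... | tri< x<y _ _ = <⇒≤ (+-monoʳ-< z x<y)
  ... | tri≈ _ x≈y _ = ≤-reflexive (+-congˡ x≈y)
  ... | tri> _ _ y<x = contradiction y<x x≤y

  +-mono-≤ : ∀ {x y u v} → x ≤ y → u ≤ v → x + u ≤ y + v
  +-mono-≤ {x} {y} {u} {v} x≤y u≤v =
    ≤-trans (+-monoʳ-≤ x u≤v)
      (≤-trans (≤-reflexive (+-comm x v)) (≤-trans (+-monoʳ-≤ v x≤y) (≤-reflexive (+-comm v y))))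

  +-monoˡ-≤ : ∀ z {x y} → x ≤ y → x + z ≤ y + z
  +-monoˡ-≤ z x≤y = +-mono-≤ x≤y ≤-refl

  +-mono-<-≤ : ∀ {x y u v} → x < y → u ≤ v → x + u < y + v
  +-mono-<-≤ {x} {y} {u} {v} x<y u≤v = <-≤-trans (+-monoˡ-< u x<y) (+-monoʳ-≤ y u≤v)

  +-mono-≤-< : ∀ {x y u v} → x ≤ y → u < v → x + u < y + v
  +-mono-≤-< {x} {y} {u} {v} x≤y u<v = ≤-<-trans (+-monoˡ-≤ u x≤y) (+-monoʳ-< y u<v)

  +-cancelˡ-≤ : ∀ z {x y} → z + x ≤ z + y → x ≤ y
  +-cancelˡ-≤ z h y<x = h (+-monoʳ-< z y<x)

  +-cancelʳ-≤ : ∀ z {x y} → x + z ≤ y + z → x ≤ y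
  +-cancelʳ-≤ z h y<x = h (+-monoˡ-< z y<x)

  +-cancelˡ-< : ∀ z {x y} → z + x < z + y → x < y
  +-cancelˡ-< z {x} {y} h with compare x y
  ... | tri< x<y _ _ = x<y
  ... | tri≈ _ x≈y _ = contradiction h (<-irrefl (+-congˡ x≈y))
  ... | tri> _ _ y<x = contradiction h (<⇒≤ (+-monoʳ-< z y<x))

  x-y+y≈x : ∀ x y → (x - y) + y ≈ x
  x-y+y≈x x y = trans (+-assoc x (- y) y) (trans (+-congˡ (+-inverseˡ y)) (+-identityʳ x))

  ≤-⇒+≤ : ∀ {x y z} → x ≤ z - y → x + y ≤ z
  ≤-⇒+≤ {x} {y} {z} h = ≤-trans (+-monoˡ-≤ y h) (≤-reflexive (x-y+y≈x z y))

  -≤⇒≤+ : ∀ {x y z} → x - y ≤ z → x ≤ z + y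
  -≤⇒≤+ {x} {y} h = ≤-trans (≤-reflexive (sym (x-y+y≈x x y))) (+-monoˡ-≤ y h)

  ≤+⇒-≤ : ∀ {x y z} → x ≤ z + y → x - y ≤ z
  ≤+⇒-≤ {x} {y} h = +-cancelʳ-≤ y (≤-trans (≤-reflexive (x-y+y≈x x y)) h)

  x≤y+x : ∀ {x y} → 0# ≤ y → x ≤ y + x
  x≤y+x {x} 0≤y = ≤-trans (≤-reflexive (sym (+-identityˡ x))) (+-monoˡ-≤ x 0≤y)

  x≤x+y : ∀ {x y} → 0# ≤ y → x ≤ x + y
  x≤x+y {x} 0≤y = ≤-trans (≤-reflexive (sym (+-identityʳ x))) (+-monoʳ-≤ x 0≤y)

  sum-mono-≤ : ∀ {n} {f g : Fin n → Carrier} → (∀ i → f i ≤ g i) → sum f ≤ sum g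
  sum-mono-≤ {ℕ.zero}  f≤g = ≤-refl
  sum-mono-≤ {ℕ.suc n} f≤g = +-mono-≤ (f≤g zero) (sum-mono-≤ (f≤g ∘ suc))

  sum-mono-< : ∀ {n} {f g : Fin n → Carrier} → (∀ i → f i ≤ g i) → ∀ i → f i < g i → sum f < sum g
  sum-mono-< f≤g zero    fi<gi = +-mono-<-≤ fi<gi (sum-mono-≤ (f≤g ∘ suc))
  sum-mono-< f≤g (suc i) fi<gi = +-mono-≤-< (f≤g zero) (sum-mono-< (f≤g ∘ suc) i fi<gi)

  sum-zero : ∀ {n} {f : Fin n → Carrier} → (∀ i → f i ≈ 0#) → sum f ≈ 0#
  sum-zero {n} f≈0 = trans (sum-cong-≋ f≈0) (sum-replicate-zero n)

  sum-only : ∀ {n} (f : Fin n → Carrier) i → (∀ j → j ≢ i → f j ≈ 0#) → sum f ≈ f i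
  sum-only f zero    h =
    trans (+-congˡ (sum-zero λ j → h (suc j) λ ())) (+-identityʳ (f zero))
  sum-only f (suc i) h =
    trans (+-cong (h zero λ ()) (sum-only (f ∘ suc) i λ j j≢i → h (suc j) λ { ≡.refl → j≢i ≡.refl }))
          (+-identityˡ _)

  sum-neg : ∀ {n} (f : Fin n → Carrier) → sum (λ i → - f i) ≈ - sum f
  sum-neg f = begin
    sum (-_ ∘ f)                             ≈⟨ +-identityʳ _ ⟨
    sum (-_ ∘ f) + 0#                        ≈⟨ +-congˡ (+-inverseʳ (sum f)) ⟨
    sum (-_ ∘ f) + (sum f - sum f)           ≈⟨ +-assoc _ _ _ ⟨
    (sum (-_ ∘ f) + sum f) - sum f           ≈⟨ +-congʳ (∑-distrib-+ (-_ ∘ f) f) ⟨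
    sum (λ i → - f i + f i) - sum f          ≈⟨ +-congʳ (sum-zero (λ i → +-inverseˡ (f i))) ⟩
    0# - sum f                               ≈⟨ +-identityˡ _ ⟩
    - sum f                                  ∎
    where open import Relation.Binary.Reasoning.Setoid setoid

  sum-update : ∀ {n} (f g : Fin n → Carrier) i → (∀ j → j ≢ i → f j ≈ g j) → sum f + g i ≈ sum g + f i
  sum-update f g i h = begin
    sum f + g i                    ≈⟨ sum-single f (g i) ⟨
    sum (λ j → f j + single (g i) j) ≈⟨ sum-cong-≋ swap ⟩
    sum (λ j → g j + single (f i) j) ≈⟨ sum-single g (f i) ⟩
    sum g + f i                    ∎
    where
    open import Relation.Binary.Reasoning.Setoid setoid
    single : Carrier → Fin _ → Carrier
    single v j = if does (j ≟ i) then v else 0#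
    sum-single : ∀ f v → sum (λ j → f j + single v j) ≈ sum f + v
    sum-single f v = trans (∑-distrib-+ f (single v)) (+-congˡ (trans
      (sum-only (single v) i λ j j≢i → reflexive (≡.cong (if_then v else 0#) (dec-false (j ≟ i) j≢i)))
      (reflexive (≡.cong (if_then v else 0#) (dec-true (i ≟ i) ≡.refl)))))
    swap : ∀ j → f j + single (g i) j ≈ g j + single (f i) j
    swap j with j ≟ i
    ... | yes ≡.refl = +-comm (f j) (g j)
    ... | no  j≢i    = +-congʳ (h j j≢i)

-- Potentials in graphs without gainful cycles

Unique-++⁻ʳ : ∀ {a} {A : Set a} (xs : List A) {ys} → Unique (xs ++ ys) → Unique ys
Unique-++⁻ʳ []       u       = u
Unique-++⁻ʳ (x ∷ xs) (_ ∷ u) = Unique-++⁻ʳ xs u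

Unique-++⁻ˡ : ∀ {a} {A : Set a} (xs : List A) {ys} → Unique (xs ++ ys) → Unique xs
Unique-++⁻ˡ []       u       = []
Unique-++⁻ˡ (x ∷ xs) (h ∷ u) = All.++⁻ˡ xs h ∷ Unique-++⁻ˡ xs u

Unique-∷ʳ : ∀ {a} {A : Set a} (x : A) xs → Unique (x ∷ xs) → Unique (xs ++ x ∷ [])
Unique-∷ʳ x xs unique@(_ ∷ unique′) = Unique-++⁺ unique′ (All.[] ∷ [])
  λ { (x∈xs , here ≡.refl) → Unique[x∷xs]⇒x∉xs unique x∈xs }

module Potential {c ℓ₁ ℓ₂ v a} (W : OrderedAbelianGroup c ℓ₁ ℓ₂)
                 {V : Set v} (_≟_ : DecidableEquality V) (Arc : V → V → Set a)
                 (gainᵃ : ∀ {i j} → Arc i j → OrderedAbelianGroup.Carrier W) where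
  open OrderedAbelianGroup W
  open OrderedGroup W

  data Walk : V → V → Set (v ⊔ a) where
    []  : ∀ {i} → Walk i i
    _∷_ : ∀ {i j k} → Arc i k → Walk k j → Walk i j

  sources : ∀ {i j} → Walk i j → List V
  sources []            = []
  sources (_∷_ {i} _ w) = i ∷ sources w

  gain : ∀ {i j} → Walk i j → Carrier
  gain []      = 0#
  gain (e ∷ w) = gainᵃ e + gain w

  _⊕_ : ∀ {i j k} → Walk i j → Walk j k → Walk i k
  []      ⊕ w′ = w′
  (e ∷ w) ⊕ w′ = e ∷ (w ⊕ w′)

  gain-⊕ : ∀ {i j k} (w : Walk i j) (w′ : Walk j k) → gain (w ⊕ w′) ≈ gain w + gain w′
  gain-⊕ []      w′ = sym (+-identityˡ _)
  gain-⊕ (e ∷ w) w′ = trans (+-congˡ (gain-⊕ w w′)) (sym (+-assoc _ _ _))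

  -- The walk `w₁` stops at the first visit to `i`, so that `simplify` can cut off `e ∷ w₁` as a
  -- simple cycle.
  splitAt : ∀ i {k j} (w : Walk k j) →
            (i ∉ˡ sources w × i ≢ j) ⊎
            (Σ[ w₁ ∈ Walk k i ] Σ[ w₂ ∈ Walk i j ]
              sources w ≡ sources w₁ ++ sources w₂ × gain w ≈ gain w₁ + gain w₂ × i ∉ˡ sources w₁)
  splitAt i {k} [] with i ≟ k
  ... | yes ≡.refl = inj₂ ([] , [] , ≡.refl , sym (+-identityˡ _) , λ ())
  ... | no  i≢k    = inj₁ ((λ ()) , i≢k)
  splitAt i {k} (e ∷ w) with i ≟ k
  ... | yes ≡.refl = inj₂ ([] , e ∷ w , ≡.refl , sym (+-identityˡ _) , λ ())
  ... | no  i≢k with splitAt i w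
  ...   | inj₁ (i∉w , i≢j) = inj₁ ((λ { (here eq) → i≢k eq ; (there i∈w) → i∉w i∈w }) , i≢j)
  ...   | inj₂ (w₁ , w₂ , eq , eq′ , i∉w₁) =
    inj₂ (e ∷ w₁ , w₂ , ≡.cong (k ∷_) eq , trans (+-congˡ eq′) (sym (+-assoc _ _ _)) ,
          λ { (here eq) → i≢k eq ; (there i∈w) → i∉w₁ i∈w })

  module _ (cycle≤0 : ∀ {i} (w : Walk i i) → Unique (sources w) → gain w ≤ 0#) where

    -- Loop erasure: every loop cut off is a simple cycle of gain at most `0#`, so cutting it loses
    -- nothing.
    simplify : ∀ {i j} (w : Walk i j) →
               Σ[ w′ ∈ Walk i j ] Unique (sources w′) × j ∉ˡ sources w′ × gain w ≤ gain w′
    simplify []                = [] , [] , (λ ()) , ≤-refl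
    simplify (_∷_ {i} e w) with simplify w
    ... | w′ , unique , j∉w′ , w≤w′ with splitAt i w′
    ...   | inj₁ (i∉w′ , i≢j) =
      e ∷ w′ , ¬Any⇒All¬ _ i∉w′ ∷ unique ,
      (λ { (here j≡i) → i≢j (≡.sym j≡i) ; (there j∈w′) → j∉w′ j∈w′ }) , +-monoʳ-≤ _ w≤w′
    ...   | inj₂ (w₁ , w₂ , eq , eq′ , i∉w₁) =
      w₂ , Unique-++⁻ʳ (sources w₁) unique′ ,
      (λ j∈w₂ → j∉w′ (≡.subst (_ ∈ˡ_) (≡.sym eq) (∈-++⁺ʳ (sources w₁) j∈w₂))) ,
      (begin
        gainᵃ e + gain w                ≤⟨ +-monoʳ-≤ _ w≤w′ ⟩
        gainᵃ e + gain w′               ≈⟨ +-congˡ eq′ ⟩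
        gainᵃ e + (gain w₁ + gain w₂)   ≈⟨ +-assoc _ _ _ ⟨
        gain (e ∷ w₁) + gain w₂         ≤⟨ +-monoˡ-≤ _ (cycle≤0 (e ∷ w₁)
                                             (¬Any⇒All¬ _ i∉w₁ ∷ Unique-++⁻ˡ (sources w₁) unique′)) ⟩
        0# + gain w₂                    ≈⟨ +-identityˡ _ ⟩
        gain w₂                         ∎)
      where
      open ≤-Reasoning
      unique′ = ≡.subst Unique eq unique

    -- The simplified walk does not leave from its own endpoint, so if it is closed it is empty.
    closed≤0 : ∀ {i} (w : Walk i i) → gain w ≤ 0#
    closed≤0 w with simplify w
    ... | []     , _ , _   , w≤w′ = w≤w′
    ... | e ∷ w′ , _ , i∉w , _    = contradiction (here ≡.refl) i∉w

    -- A table of the walk gains known so far instead of a maximum over all walks: `attained` backs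
    -- each entry by a walk, and `triangle` accounts for concatenation. Arcs enter one at a time
    -- through `addArc`, so walks never have to be enumerated.
    record Distance : Set (c ⊔ ℓ₂ ⊔ v ⊔ a) where
      field
        d        : V → V → Carrier
        attained : ∀ i j → Σ[ w ∈ Walk i j ] d i j ≤ gain w
        triangle : ∀ i j k → d i k + d k j ≤ d i j
        d-nonneg : ∀ i → 0# ≤ d i i

      d-closed : ∀ {i j} (w : Walk j i) → d i j + gain w ≤ 0#
      d-closed {i} {j} w = let w′ , d≤w′ = attained i j in begin
        d i j + gain w      ≤⟨ +-monoˡ-≤ _ d≤w′ ⟩
        gain w′ + gain w    ≈⟨ gain-⊕ w′ w ⟨
        gain (w′ ⊕ w)       ≤⟨ closed≤0 (w′ ⊕ w) ⟩
        0#                  ∎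
        where open ≤-Reasoning

    open Distance

    infix 4 _⊑_
    _⊑_ : Distance → Distance → Set (ℓ₂ ⊔ v)
    D ⊑ D′ = ∀ i j → d D i j ≤ d D′ i j

    -- All routes lead through the hub `o`. Leaving `o` is free, so an entry between distinct
    -- vertices depends on its start only.
    starDistance : ∀ o → (∀ i → Walk i o) → (∀ j → Σ[ w ∈ Walk o j ] gain w ≈ 0#) → Distance
    starDistance o out back = record
      { d = d₀ ; attained = attained₀ ; triangle = triangle₀ ; d-nonneg = d₀-nonneg }
      where
      open ≤-Reasoning
      d₀ : V → V → Carrier
      d₀ i j with i ≟ j
      ... | yes _ = 0#
      ... | no  _ = gain (out i)
      out≤0 : ∀ i → gain (out i) ≤ 0#
      out≤0 i = let w , w≈0 = back i in begin
        gain (out i)            ≈⟨ +-identityʳ _ ⟨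
        gain (out i) + 0#       ≈⟨ +-congˡ w≈0 ⟨
        gain (out i) + gain w   ≈⟨ gain-⊕ (out i) w ⟨
        gain (out i ⊕ w)        ≤⟨ closed≤0 (out i ⊕ w) ⟩
        0#                      ∎
      attained₀ : ∀ i j → Σ[ w ∈ Walk i j ] d₀ i j ≤ gain w
      attained₀ i j with i ≟ j
      ... | yes ≡.refl = [] , ≤-refl
      ... | no  _      = let w , w≈0 = back j in
        out i ⊕ w , ≤-reflexive (sym (trans (gain-⊕ (out i) w) (trans (+-congˡ w≈0) (+-identityʳ _))))
      d₀≤0 : ∀ i j → d₀ i j ≤ 0#
      d₀≤0 i j with i ≟ j
      ... | yes _ = ≤-refl
      ... | no  _ = out≤0 i
      out≤d₀ : ∀ i j → gain (out i) ≤ d₀ i j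
      out≤d₀ i j with i ≟ j
      ... | yes _ = out≤0 i
      ... | no  _ = ≤-refl
      triangle₀ : ∀ i j k → d₀ i k + d₀ k j ≤ d₀ i j
      triangle₀ i j k with i ≟ k
      ... | yes ≡.refl = ≤-reflexive (+-identityˡ _)
      ... | no  _      = begin
        gain (out i) + d₀ k j   ≤⟨ +-monoʳ-≤ _ (d₀≤0 k j) ⟩
        gain (out i) + 0#       ≈⟨ +-identityʳ _ ⟩
        gain (out i)            ≤⟨ out≤d₀ i j ⟩
        d₀ i j                  ∎
      d₀-nonneg : ∀ i → 0# ≤ d₀ i i
      d₀-nonneg i with i ≟ i
      ... | yes _   = ≤-refl
      ... | no  i≢i = contradiction ≡.refl i≢i

    -- Each entry becomes the maximum of the old one and the detour through `e`. One passage of `e`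
    -- is enough: between two passages lies a closed walk, which gains at most `0#` (`via-via`).
    addArc : (D : Distance) → ∀ {s t} (e : Arc s t) →
             Σ[ D′ ∈ Distance ] D ⊑ D′ × gainᵃ e ≤ d D′ s t
    addArc D {s} {t} e = D′ , old≤ , e≤
      where
      open ≤-Reasoning
      g = gainᵃ e
      via : V → V → Carrier
      via i j = d D i s + (g + d D t j)
      choice : ∀ i j → d D i j ≤ via i j ⊎ via i j ≤ d D i j
      choice i j = ≤-total (d D i j) (via i j)
      d′ : V → V → Carrier
      d′ i j = [ (λ _ → via i j) , (λ _ → d D i j) ]′ (choice i j)
      old≤ : ∀ i j → d D i j ≤ d′ i j
      old≤ i j with choice i j
      ... | inj₁ p = p
      ... | inj₂ _ = ≤-refl
      via≤ : ∀ i j → via i j ≤ d′ i j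
      via≤ i j with choice i j
      ... | inj₁ _ = ≤-refl
      ... | inj₂ p = p
      d′-cases : ∀ i j → d′ i j ≡ d D i j ⊎ d′ i j ≡ via i j
      d′-cases i j with choice i j
      ... | inj₁ _ = inj₂ ≡.refl
      ... | inj₂ _ = inj₁ ≡.refl
      via-left : ∀ i j k → d D i k + via k j ≤ d′ i j
      via-left i j k = begin
        d D i k + (d D k s + (g + d D t j))   ≈⟨ +-assoc _ _ _ ⟨
        (d D i k + d D k s) + (g + d D t j)   ≤⟨ +-monoˡ-≤ _ (triangle D i s k) ⟩
        via i j                               ≤⟨ via≤ i j ⟩
        d′ i j                                ∎
      via-right : ∀ i j k → via i k + d D k j ≤ via i j
      via-right i j k = begin
        (d D i s + (g + d D t k)) + d D k j   ≈⟨ +-assoc _ _ _ ⟩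
        d D i s + ((g + d D t k) + d D k j)   ≈⟨ +-congˡ (+-assoc _ _ _) ⟩
        d D i s + (g + (d D t k + d D k j))   ≤⟨ +-monoʳ-≤ _ (+-monoʳ-≤ g (triangle D t j k)) ⟩
        via i j                               ∎
      via-via : ∀ i j k → via i k + via k j ≤ via i j
      via-via i j k = begin
        via i k + (d D k s + (g + d D t j))       ≈⟨ +-assoc _ _ _ ⟨
        (via i k + d D k s) + (g + d D t j)       ≤⟨ +-monoˡ-≤ _ (via-right i s k) ⟩
        (d D i s + (g + d D t s)) + (g + d D t j) ≤⟨ +-monoˡ-≤ _ (+-monoʳ-≤ _ loop≤0) ⟩
        (d D i s + 0#) + (g + d D t j)            ≈⟨ +-congʳ (+-identityʳ _) ⟩
        via i j                                   ∎
        where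
        loop≤0 : g + d D t s ≤ 0#
        loop≤0 = begin
          g + d D t s           ≈⟨ +-comm _ _ ⟩
          d D t s + g           ≈⟨ +-congˡ (+-identityʳ g) ⟨
          d D t s + (g + 0#)    ≤⟨ d-closed D (e ∷ []) ⟩
          0#                    ∎
      triangle′ : ∀ i j k → d′ i k + d′ k j ≤ d′ i j
      triangle′ i j k with d′-cases i k | d′-cases k j
      ... | inj₁ p | inj₁ q rewrite p | q = ≤-trans (triangle D i j k) (old≤ i j)
      ... | inj₁ p | inj₂ q rewrite p | q = via-left i j k
      ... | inj₂ p | inj₁ q rewrite p | q = ≤-trans (via-right i j k) (via≤ i j)
      ... | inj₂ p | inj₂ q rewrite p | q = ≤-trans (via-via i j k) (via≤ i j)
      attained′ : ∀ i j → Σ[ w ∈ Walk i j ] d′ i j ≤ gain w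
      attained′ i j with d′-cases i j
      ... | inj₁ p rewrite p = attained D i j
      ... | inj₂ p rewrite p = let w , ≤w = attained D i s ; w′ , ≤w′ = attained D t j in
        w ⊕ (e ∷ w′) , (begin
          d D i s + (g + d D t j)   ≤⟨ +-mono-≤ ≤w (+-monoʳ-≤ g ≤w′) ⟩
          gain w + gain (e ∷ w′)    ≈⟨ gain-⊕ w (e ∷ w′) ⟨
          gain (w ⊕ (e ∷ w′))       ∎)
      D′ : Distance
      D′ = record { d = d′ ; attained = attained′ ; triangle = triangle′
                  ; d-nonneg = λ i → ≤-trans (d-nonneg D i) (old≤ i i) }
      e≤ : g ≤ d′ s t
      e≤ = begin
        g                    ≤⟨ x≤x+y (d-nonneg D t) ⟩
        g + d D t t          ≤⟨ x≤y+x (d-nonneg D s) ⟩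
        via s t              ≤⟨ via≤ s t ⟩
        d′ s t               ∎

    -- Requirements once met survive the growth of the table, so finitely many can be met in turn.
    collect : ∀ {q k} (Q : Fin k → Distance → Set q) → (∀ i {D D′} → D ⊑ D′ → Q i D → Q i D′) →
              (∀ i D → Σ[ D′ ∈ Distance ] D ⊑ D′ × Q i D′) →
              ∀ D → Σ[ D′ ∈ Distance ] D ⊑ D′ × (∀ i → Q i D′)
    collect {k = ℕ.zero}  Q up add D = D , (λ _ _ → ≤-refl) , λ ()
    collect {k = ℕ.suc k} Q up add D =
      let D₁ , D⊑D₁ , q₀ = add zero D
          D₂ , D₁⊑D₂ , qs = collect (Q ∘ suc) (up ∘ suc) (add ∘ suc) D₁
      in D₂ , (λ i j → ≤-trans (D⊑D₁ i j) (D₁⊑D₂ i j)) ,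
         λ { zero → up zero D₁⊑D₂ q₀ ; (suc i) → qs i }

-- Duality for the assignment problem

module Assignment {c ℓ₁ ℓ₂ e} (W : OrderedAbelianGroup c ℓ₁ ℓ₂) {n m}
                  (E : Fin n → Fin m → Set e)
                  (u : Fin n → Maybe (Fin m) → OrderedAbelianGroup.Carrier W) where
  open OrderedAbelianGroup W
  open OrderedGroup W

  Assign : Set
  Assign = Fin n → Maybe (Fin m)

  Injectiveᵐ : Assign → Set
  Injectiveᵐ N = ∀ x y p → N x ≡ just p → N y ≡ just p → x ≡ y

  Allowed : Assign → Set e
  Allowed N = ∀ x p → N x ≡ just p → E x p

  Idle : Assign → Fin m → Set
  Idle N p = ∀ x → N x ≢ just p

  value : Assign → Carrier
  value N = sum λ x → u x (N x)

  Option : Fin n → Maybe (Fin m) → Set e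
  Option x (just p) = E x p
  Option x nothing  = Lift e ⊤

  price : (Fin m → Carrier) → Maybe (Fin m) → Carrier
  price β = maybe′ β 0#

  -- `dual` says that `M x` maximises utility minus price among the options of `x`, written without
  -- subtraction. That maximum is the dual variable of `x`, which is thereby eliminated; `idle` is
  -- complementary slackness for jobs.
  record Feasible (M : Assign) (β : Fin m → Carrier) : Set (ℓ₂ ⊔ e) where
    field
      nonneg : ∀ p → 0# ≤ β p
      idle   : ∀ p → Idle M p → β p ≤ 0#
      dual   : ∀ x o → Option x o → price β (M x) + u x o ≤ price β o + u x (M x)

  module Income (β : Fin m → Carrier) where

    share : Maybe (Fin m) → Fin m → Carrier
    share o p = if does (≡-dec _≟_ o (just p)) then β p else 0#

    price≈ : ∀ o → price β o ≈ sum (share o)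
    price≈ nothing  = sym (sum-zero {f = share nothing} λ _ → refl)
    price≈ (just p) = sym (trans (sum-only (share (just p)) p λ q q≢p → reflexive
        (≡.cong (if_then β q else 0#) (dec-false (≡-dec _≟_ (just p) (just q)) (q≢p ∘ ≡.sym ∘ just-injective))))
      (reflexive (≡.cong (if_then β p else 0#) (dec-true (≡-dec _≟_ (just p) (just p)) ≡.refl))))

    received : Assign → Fin m → Carrier
    received N p = sum λ x → share (N x) p

    income : Assign → Carrier
    income N = sum λ x → price β (N x)

    income≈ : ∀ N → income N ≈ sum (received N)
    income≈ N = trans (sum-cong-≋ (price≈ ∘ N)) (∑-comm λ x p → share (N x) p)

    received-idle : ∀ N p → Idle N p → received N p ≈ 0#
    received-idle N p free = sum-zero λ x →
      reflexive (≡.cong (if_then β p else 0#) (dec-false (≡-dec _≟_ (N x) (just p)) (free x)))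

    received-busy : ∀ N → Injectiveᵐ N → ∀ {x p} → N x ≡ just p → received N p ≈ β p
    received-busy N inj {x} {p} eq = trans
      (sum-only (λ x → share (N x) p) x λ y y≢x → reflexive
        (≡.cong (if_then β p else 0#) (dec-false (≡-dec _≟_ (N y) (just p)) λ eq′ → y≢x (inj y x p eq′ eq))))
      (reflexive (≡.cong (if_then β p else 0#) (dec-true (≡-dec _≟_ (N x) (just p)) eq)))

    busy? : ∀ N p → (∃[ x ] N x ≡ just p) ⊎ Idle N p
    busy? N p with any? (λ x → ≡-dec _≟_ (N x) (just p))
    ... | yes b = inj₁ b
    ... | no ¬b = inj₂ λ x eq → ¬b (x , eq)

    module _ {M} (M-inj : Injectiveᵐ M) (feasible : Feasible M β) where
      open Feasible feasible

      income-M : income M ≈ sum β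
      income-M = trans (income≈ M) (sum-cong-≋ λ p →
        [ (λ (_ , eq) → received-busy M M-inj eq)
        , (λ free → trans (received-idle M p free) (≤-antisym (nonneg p) (idle p free))) ]′ (busy? M p))

      received≤ : ∀ {N} → Injectiveᵐ N → ∀ p → received N p ≤ β p
      received≤ {N} N-inj p =
        [ (λ (_ , eq) → ≤-reflexive (received-busy N N-inj eq))
        , (λ free → ≤-trans (≤-reflexive (received-idle N p free)) (nonneg p)) ]′ (busy? N p)

      -- `M` collects the price of every job with a positive price, so its income is already the sum
      -- of all prices.
      income≤ : ∀ {N} → Injectiveᵐ N → income N ≤ income M
      income≤ {N} N-inj = begin
        income N           ≈⟨ income≈ N ⟩
        sum (received N)   ≤⟨ sum-mono-≤ (received≤ N-inj) ⟩
        sum β              ≈⟨ income-M ⟨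
        income M           ∎
        where open ≤-Reasoning

      income< : ∀ {N} → Injectiveᵐ N → ∀ p → Idle N p → 0# < β p → income N < income M
      income< {N} N-inj p free 0<βp = begin-strict
        income N           ≈⟨ income≈ N ⟩
        sum (received N)   <⟨ sum-mono-< (received≤ N-inj) p (<-respˡ-≈ (sym (received-idle N p free)) 0<βp) ⟩
        sum β              ≈⟨ income-M ⟨
        income M           ∎
        where open ≤-Reasoning

  module _ {M} (M-inj : Injectiveᵐ M) {β} (feasible : Feasible M β)
           {N} (N-inj : Injectiveᵐ N) (N-allowed : Allowed N) where
    open Feasible feasible
    open Income β
    open ≤-Reasoning

    private
      option : ∀ x → Option x (N x)
      option x with N x in eq
      ... | just p  = N-allowed x p eq
      ... | nothing = lift tt

      paid : Assign → Assign → Fin n → Carrier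
      paid K L x = price β (K x) + u x (L x)

      paid≈ : ∀ K L → sum (paid K L) ≈ income K + value L
      paid≈ K L = ∑-distrib-+ (price β ∘ K) (λ x → u x (L x))

      paid≤ : ∀ x → paid M N x ≤ paid N M x
      paid≤ x = dual x (N x) (option x)

    -- Summed over the applicants, `dual` bounds the gain in value by the gain in income, which is
    -- never positive.
    weak-duality : value N ≤ value M
    weak-duality = +-cancelˡ-≤ (income M) (begin
      income M + value N   ≈⟨ paid≈ M N ⟨
      sum (paid M N)       ≤⟨ sum-mono-≤ paid≤ ⟩
      sum (paid N M)       ≈⟨ paid≈ N M ⟩
      income N + value M   ≤⟨ +-monoˡ-≤ _ (income≤ M-inj feasible N-inj) ⟩
      income M + value M   ∎)

    module _ (N-optimal : value M ≤ value N) where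

      -- Strictness at one applicant would make the chain of `weak-duality` strict, against the
      -- optimality of `N`. Together with `slack-job` this lets prices for `M` serve `N`, which is
      -- what `cover-transfer` needs.
      slack-applicant : ∀ x → price β (N x) + u x (M x) ≤ price β (M x) + u x (N x)
      slack-applicant x loss = N-optimal (+-cancelˡ-< (income M) (begin-strict
        income M + value N   ≈⟨ paid≈ M N ⟨
        sum (paid M N)       <⟨ sum-mono-< paid≤ x loss ⟩
        sum (paid N M)       ≈⟨ paid≈ N M ⟩
        income N + value M   ≤⟨ +-monoˡ-≤ _ (income≤ M-inj feasible N-inj) ⟩
        income M + value M   ∎))

      slack-job : ∀ p → Idle N p → β p ≤ 0#
      slack-job p free 0<βp = N-optimal (+-cancelˡ-< (income M) (begin-strict
        income M + value N   ≈⟨ paid≈ M N ⟨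
        sum (paid M N)       ≤⟨ sum-mono-≤ paid≤ ⟩
        sum (paid N M)       ≈⟨ paid≈ N M ⟩
        income N + value M   <⟨ +-monoˡ-< _ (income< M-inj feasible N-inj p free 0<βp) ⟩
        income M + value M   ∎))

  module Strong (E? : ∀ x p → Dec (E x p)) {M} (M-inj : Injectiveᵐ M) (M-allowed : Allowed M)
                (M-optimal : ∀ N → Injectiveᵐ N → Allowed N → value N ≤ value M) where

    -- A walk moves each applicant on it to the place that the next one leaves; the node
    -- `nothing` stands for all places outside the jobs.
    data Arc : Maybe (Fin m) → Maybe (Fin m) → Set e where
      move : ∀ {i o} x → M x ≡ i → Option x o → Arc i o
      idle : ∀ {p} → Idle M p → Arc (just p) nothing
      drop : ∀ p → Arc nothing (just p)

    gainᵃ : ∀ {i j} → Arc i j → Carrier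
    gainᵃ (move {i} {o} x _ _) = u x o - u x i
    gainᵃ (idle _)             = 0#
    gainᵃ (drop _)             = 0#

    open Potential W (≡-dec _≟_) Arc gainᵃ

    -- The arcs `idle` and `drop` move nobody: a chain of moves may end at a vacant job, and the job
    -- at which it starts may be left vacant.
    reassign : ∀ {i j} → Walk i j → Assign
    reassign []                         y = M y
    reassign (move {o = o} x _ _ ∷ w) y = if does (y ≟ x) then o else reassign w y
    reassign (idle _ ∷ w)             y = reassign w y
    reassign (drop _ ∷ w)             y = reassign w y

    data Moved : ∀ {i j} → Walk i j → Fin n → Maybe (Fin m) → Set e where
      here  : ∀ {i o j x} {eq : M x ≡ i} {opt : Option x o} {w : Walk o j} → Moved (move x eq opt ∷ w) x o
      there : ∀ {i k j x o} {a : Arc i k} {w : Walk k j} → Moved w x o → Moved (a ∷ w) x o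

    targets : ∀ {i j} → Walk i j → List (Maybe (Fin m))
    targets []                = []
    targets (_∷_ {k = k} _ w) = k ∷ targets w

    sources-targets : ∀ {i j} (w : Walk i j) → i ∷ targets w ≡ sources w ++ j ∷ []
    sources-targets []            = ≡.refl
    sources-targets (_∷_ {i} _ w) = ≡.cong (i ∷_) (sources-targets w)

    moved-source : ∀ {i j x o} {w : Walk i j} → Moved w x o → M x ∈ˡ sources w
    moved-source (here {eq = eq}) = here eq
    moved-source (there m)        = there (moved-source m)

    moved-target : ∀ {i j x o} {w : Walk i j} → Moved w x o → o ∈ˡ targets w
    moved-target here      = here ≡.refl
    moved-target (there m) = there (moved-target m)

    moved-option : ∀ {i j x o} {w : Walk i j} → Moved w x o → Option x o
    moved-option (here {opt = opt}) = opt
    moved-option (there m)          = moved-option m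

    moved-unique : ∀ {i j x y o} {w : Walk i j} → Unique (targets w) → Moved w x o → Moved w y o → x ≡ y
    moved-unique unique      here       here       = ≡.refl
    moved-unique unique      here       (there m′) = contradiction (moved-target m′) (Unique[x∷xs]⇒x∉xs unique)
    moved-unique unique      (there m)  here       = contradiction (moved-target m) (Unique[x∷xs]⇒x∉xs unique)
    moved-unique (_ ∷ unique) (there m) (there m′) = moved-unique unique m m′

    source-moved : ∀ {i j x p} (w : Walk i j) → M x ≡ just p → just p ∈ˡ sources w → ∃[ o ] Moved w x o
    source-moved {x = x} (move y eq _ ∷ w) Mx (here ≡.refl)
      rewrite M-inj x y _ Mx eq = _ , here
    source-moved {x = x} (idle free ∷ w) Mx (here ≡.refl) = contradiction Mx (free x)
    source-moved (a ∷ w) Mx (there p∈w) = let o , m = source-moved w Mx p∈w in o , there m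

    reassign-cases : ∀ {i j} (w : Walk i j) y →
                     (reassign w y ≡ M y × (∀ o → ¬ Moved w y o)) ⊎ Moved w y (reassign w y)
    reassign-cases [] y = inj₁ (≡.refl , λ _ ())
    reassign-cases (move x _ _ ∷ w) y with y ≟ x
    ... | yes ≡.refl = inj₂ here
    ... | no  y≢x with reassign-cases w y
    ...   | inj₁ (eq , ¬m) = inj₁ (eq , λ { _ here → y≢x ≡.refl ; o (there m) → ¬m o m })
    ...   | inj₂ m         = inj₂ (there m)
    reassign-cases (idle _ ∷ w) y with reassign-cases w y
    ... | inj₁ (eq , ¬m) = inj₁ (eq , λ { o (there m) → ¬m o m })
    ... | inj₂ m         = inj₂ (there m)
    reassign-cases (drop _ ∷ w) y with reassign-cases w y
    ... | inj₁ (eq , ¬m) = inj₁ (eq , λ { o (there m) → ¬m o m })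
    ... | inj₂ m         = inj₂ (there m)

    reassign-fixed : ∀ {i j} (w : Walk i j) {x} → M x ∉ˡ sources w → reassign w x ≡ M x
    reassign-fixed w {x} x∉w with reassign-cases w x
    ... | inj₁ (eq , _) = eq
    ... | inj₂ m        = contradiction (moved-source m) x∉w

    -- Distinct sources mean distinct movers, so no change is overwritten: the first mover still has
    -- her old place after the moves of `w` (`fixed`).
    value-reassign : ∀ {i j} (w : Walk i j) → Unique (sources w) → value (reassign w) ≈ value M + gain w
    value-reassign [] _ = sym (+-identityʳ _)
    value-reassign (idle _ ∷ w) (_ ∷ unique) = trans (value-reassign w unique) (+-congˡ (sym (+-identityˡ _)))
    value-reassign (drop _ ∷ w) (_ ∷ unique) = trans (value-reassign w unique) (+-congˡ (sym (+-identityˡ _)))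
    value-reassign w₀@(move {o = o} x ≡.refl _ ∷ w) unique₀@(_ ∷ unique) = begin
        value N₀                                       ≈⟨ +-identityʳ _ ⟨
        value N₀ + 0#                                  ≈⟨ +-congˡ (+-inverseʳ _) ⟨
        value N₀ + (u x (M x) - u x (M x))             ≈⟨ +-assoc _ _ _ ⟨
        (value N₀ + u x (M x)) - u x (M x)             ≈⟨ +-congʳ (+-congˡ (reflexive (≡.cong (u x) fixed))) ⟨
        (value N₀ + u x (N x)) - u x (M x)             ≈⟨ +-congʳ (sum-update _ _ x off) ⟩
        (value N + u x (N₀ x)) - u x (M x)             ≈⟨ +-congʳ (+-congˡ (reflexive (≡.cong (u x) new))) ⟩
        (value N + u x o) - u x (M x)                  ≈⟨ +-assoc _ _ _ ⟩
        value N + (u x o - u x (M x))                  ≈⟨ +-congʳ (value-reassign w unique) ⟩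
        (value M + gain w) + (u x o - u x (M x))       ≈⟨ +-assoc _ _ _ ⟩
        value M + (gain w + (u x o - u x (M x)))       ≈⟨ +-congˡ (+-comm _ _) ⟩
        value M + gain w₀                              ∎
      where
      open import Relation.Binary.Reasoning.Setoid setoid
      N₀ N : Assign
      N₀ = reassign w₀
      N  = reassign w
      fixed : N x ≡ M x
      fixed = reassign-fixed w (Unique[x∷xs]⇒x∉xs unique₀)
      new : N₀ x ≡ o
      new = ≡.cong (if_then o else N x) (dec-true (x ≟ x) ≡.refl)
      off : ∀ y → y ≢ x → u y (N₀ y) ≈ u y (N y)
      off y y≢x = reflexive (≡.cong (u y) (≡.cong (if_then o else N y) (dec-false (y ≟ x) y≢x)))

    targets-unique : ∀ {i} (w : Walk i i) → Unique (sources w) → Unique (targets w)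
    targets-unique []      _ = []
    targets-unique {i} w@(_ ∷ w′) unique =
      ≡.subst Unique (≡.sym (∷-injectiveʳ (sources-targets w))) (Unique-∷ʳ i (sources w′) unique)

    targets⊆sources : ∀ {i o} (w : Walk i i) → o ∈ˡ targets w → o ∈ˡ sources w
    targets⊆sources {i} {o} w@(_ ∷ w′) o∈
      with ∈-++⁻ (sources w′) (≡.subst (o ∈ˡ_) (∷-injectiveʳ (sources-targets w)) o∈)
    ... | inj₁ o∈w′        = there o∈w′
    ... | inj₂ (here o≡i)  = here o≡i

    -- On a simple closed walk the targets are the sources rotated. Hence two movers get different
    -- places, and a job taken by a mover has been left by its former holder.
    reassign-injective : ∀ {i} (w : Walk i i) → Unique (sources w) → Injectiveᵐ (reassign w)
    reassign-injective w unique x y p eqx eqy with reassign-cases w x | reassign-cases w y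
    ... | inj₁ (fx , _)  | inj₁ (fy , _)  = M-inj x y p (≡.trans (≡.sym fx) eqx) (≡.trans (≡.sym fy) eqy)
    ... | inj₂ mx        | inj₂ my        rewrite eqx | eqy = moved-unique (targets-unique w unique) mx my
    ... | inj₁ (fx , ¬m) | inj₂ my        rewrite eqy =
      let o , m = source-moved w (≡.trans (≡.sym fx) eqx) (targets⊆sources w (moved-target my))
      in contradiction m (¬m o)
    ... | inj₂ mx        | inj₁ (fy , ¬m) rewrite eqx =
      let o , m = source-moved w (≡.trans (≡.sym fy) eqy) (targets⊆sources w (moved-target mx))
      in contradiction m (¬m o)

    reassign-allowed : ∀ {i j} (w : Walk i j) → Allowed (reassign w)
    reassign-allowed w x p eq with reassign-cases w x
    ... | inj₁ (fx , _) = M-allowed x p (≡.trans (≡.sym fx) eq)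
    ... | inj₂ m rewrite eq = moved-option m

    cycle≤0 : ∀ {i} (w : Walk i i) → Unique (sources w) → gain w ≤ 0#
    cycle≤0 w unique = +-cancelˡ-≤ (value M) (begin
      value M + gain w     ≈⟨ value-reassign w unique ⟨
      value (reassign w)   ≤⟨ M-optimal (reassign w) (reassign-injective w unique) (reassign-allowed w) ⟩
      value M              ≈⟨ +-identityʳ _ ⟨
      value M + 0#         ∎)
      where open ≤-Reasoning

    out : ∀ i → Walk i nothing
    out nothing  = []
    out (just p) with any? (λ x → ≡-dec _≟_ (M x) (just p))
    ... | yes (x , eq) = move x eq (lift tt) ∷ []
    ... | no  ¬busy    = idle (λ x eq → ¬busy (x , eq)) ∷ []

    back : ∀ j → Σ[ w ∈ Walk nothing j ] gain w ≈ 0#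
    back nothing  = [] , refl
    back (just p) = drop p ∷ [] , +-identityʳ 0#

    private
      star : Distance cycle≤0
      star = starDistance cycle≤0 nothing out back

      Moves : Fin n → Fin m → Distance cycle≤0 → Set _
      Moves x p D = E x p → u x (just p) - u x (M x) ≤ Distance.d D (M x) (just p)

      -- Only moves into jobs are entered in the table. Arcs ending in `nothing` close a walk from
      -- `nothing`, so `d-closed` deals with them directly.
      all-moves : Σ[ D ∈ Distance cycle≤0 ] _⊑_ cycle≤0 star D × (∀ x p → Moves x p D)
      all-moves = collect cycle≤0 (λ x D → ∀ p → Moves x p D)
        (λ x D⊑ h p xp → ≤-trans (h p xp) (D⊑ _ _))
        (λ x → collect cycle≤0 (Moves x) (λ p D⊑ h xp → ≤-trans (h xp) (D⊑ _ _)) (λ p D → add x p D)) star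
        where
        add : ∀ x p D → Σ[ D′ ∈ Distance cycle≤0 ] _⊑_ cycle≤0 D D′ × Moves x p D′
        add x p D with E? x p
        ... | yes xp = let D′ , D⊑ , h = addArc cycle≤0 D (move x ≡.refl xp) in D′ , D⊑ , λ _ → h
        ... | no ¬xp = D , (λ _ _ → ≤-refl) , λ xp → contradiction xp ¬xp

    abstract
      strong-duality : ∃ (Feasible M)
      strong-duality = β , record { nonneg = β-nonneg ; idle = β-idle ; dual = β-dual }
        where
        open ≤-Reasoning
        D : Distance cycle≤0
        D = proj₁ all-moves
        open Distance D
        β : Fin m → Carrier
        -- A price is the tabled gain of a best walk to the job from outside. The initial star has
        -- `0#` here, which gives `β-nonneg`.
        β p = d nothing (just p)
        β-nonneg : ∀ p → 0# ≤ β p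
        β-nonneg p = proj₁ (proj₂ all-moves) nothing (just p)
        β-idle : ∀ p → Idle M p → β p ≤ 0#
        β-idle p free = begin
          β p              ≈⟨ +-identityʳ _ ⟨
          β p + 0#         ≈⟨ +-congˡ (+-identityʳ _) ⟨
          β p + (0# + 0#)  ≤⟨ d-closed (idle free ∷ []) ⟩
          0#               ∎
        price≤ : ∀ o → price β o ≤ d nothing o
        price≤ nothing  = d-nonneg nothing
        price≤ (just p) = ≤-refl
        convert : ∀ {a b c z} → a + (b - c) ≤ z → a + b ≤ z + c
        convert h = -≤⇒≤+ (≤-trans (≤-reflexive (+-assoc _ _ _)) h)
        β-dual : ∀ x o → Option x o → price β (M x) + u x o ≤ price β o + u x (M x)
        β-dual x o opt = convert (≤-trans (+-monoˡ-≤ _ (price≤ (M x))) (bound o opt))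
          where
          bound : ∀ o → Option x o → d nothing (M x) + (u x o - u x (M x)) ≤ price β o
          bound nothing  opt = begin
            d nothing (M x) + (u x nothing - u x (M x))         ≈⟨ +-congˡ (+-identityʳ _) ⟨
            d nothing (M x) + ((u x nothing - u x (M x)) + 0#)  ≤⟨ d-closed (move x ≡.refl opt ∷ []) ⟩
            0#                                                  ∎
          bound (just p) xp = begin
            d nothing (M x) + (u x (just p) - u x (M x))  ≤⟨ +-monoʳ-≤ _ (proj₂ (proj₂ all-moves) x p xp) ⟩
            d nothing (M x) + d (M x) (just p)            ≤⟨ triangle nothing (just p) (M x) ⟩
            β p                                           ∎

-- Maximum matchings and vertex covers

ℤ-orderedAbelianGroup : OrderedAbelianGroup 0ℓ 0ℓ 0ℓ
ℤ-orderedAbelianGroup = record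
  { isAbelianGroup     = ℤ.+-0-isAbelianGroup
  ; isStrictTotalOrder = ℤ.<-isStrictTotalOrder
  ; +-monoʳ-<          = ℤ.+-monoʳ-<
  }

module Covers {c ℓ₁ ℓ₂} {W : OrderedAbelianGroup c ℓ₁ ℓ₂} (I : Instance W) where
  open Instance I
  open PopularMatching I
  open OrderedGroup ℤ-orderedAbelianGroup
    using (sum; _≤_; ≤-reflexive; ≤-trans; +-monoˡ-≤; +-cancelˡ-≤;
           sum-zero; sum-only; ∑-distrib-+; sum-cong-≗; <-≤-trans; module ≤-Reasoning)

  matched? : ∀ M v → Dec (Matched M v)
  matched? M (inj₁ x) with mate M x
  ... | just p  = yes (p , ≡.refl)
  ... | nothing = no λ ()
  matched? M (inj₂ p) = any? λ x → ≡-dec _≟_ (mate M x) (just p)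

  count : ∀ {A : Set} → Maybe A → ℤ
  count = maybe′ (λ _ → + 1) (+ 0)

  indicator : ∀ {a} {A : Set a} → Dec A → ℤ
  indicator A? = if does A? then + 1 else + 0

  indicator-yes : ∀ {a} {A : Set a} (A? : Dec A) → A → indicator A? ≡ + 1
  indicator-yes A? a = ≡.cong (if_then + 1 else + 0) (dec-true A? a)

  indicator-no : ∀ {a} {A : Set a} (A? : Dec A) → ¬ A → indicator A? ≡ + 0
  indicator-no A? ¬a = ≡.cong (if_then + 1 else + 0) (dec-false A? ¬a)

  sum-count : ∀ {A : Set} {n} (f : Fin n → Maybe A) →
              sum (count ∘ f) ≡ + ∣ tabulate (is-just ∘ f) ∣
  sum-count {n = ℕ.zero}  f = ≡.refl
  sum-count {n = ℕ.suc n} f with f zero | sum-count (f ∘ suc)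
  ... | just _  | eq = ≡.cong (ℤ.suc) eq
  ... | nothing | eq = ≡.trans (ℤ.+-identityˡ _) eq

  -- P together with the applicants that M matches outside P is a vertex cover of H as
  -- large as M (König).
  record Cover {p} (H : Graph 0ℓ) (M : Matching) (P : Pred Job p) : Set p where
    field
      decide  : Decidable P
      busy    : ∀ {p} → P p → ∃[ x ] edges M x p
      closed  : ∀ {x p q} → edges M x p → P p → H x q → P q
      exposed : ∀ {x q} → mate M x ≡ nothing → H x q → P q

  module _ {p} {H : Graph 0ℓ} {M} {P : Pred Job p} (M⊆H : edges M ⇒ H) (cover : Cover H M P) where
    open Cover cover
    open Assignment ℤ-orderedAbelianGroup H (λ _ → count)

    private
      β : Job → ℤ
      β p = indicator (decide p)

      M-value : ∀ N → value (mate N) ≡ + size N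
      M-value N = sum-count (mate N)

      -- With `count` as utility the indicator of a cover is a price system: `closed` is the price
      -- condition for matched applicants and `exposed` that for unmatched ones.
      feasible : Feasible (mate M) β
      feasible = record { nonneg = nonneg ; idle = idle ; dual = dual }
        where
        nonneg : ∀ p → + 0 ≤ β p
        nonneg p β<0 with decide p
        nonneg p (+<+ ()) | yes _
        nonneg p (+<+ ()) | no  _
        idle : ∀ p → Idle (mate M) p → β p ≤ + 0
        idle p free 0<β with decide p
        ... | yes Pp = let x , eq = busy Pp in free x eq
        idle p free (+<+ ()) | no _
        dual : ∀ x o → Option x o → price β (mate M x) ℤ.+ count o ≤ price β o ℤ.+ count (mate M x)
        dual x nothing _ h with mate M x
        ... | nothing = ℤ.<-irrefl ≡.refl h
        ... | just p with decide p
        dual x nothing _ (+<+ (s≤s ())) | just p | yes _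
        dual x nothing _ (+<+ ())       | just p | no  _
        dual x (just q) xq h with mate M x in eq
        dual x (just q) xq h | nothing with decide q
        dual x (just q) xq (+<+ (s≤s ())) | nothing | yes _
        ... | no ¬Pq = ¬Pq (exposed eq xq)
        dual x (just q) xq h | just p with decide p | decide q
        dual x (just q) xq (+<+ (s≤s (s≤s ()))) | just p | yes _ | yes _
        ... | yes Pp | no ¬Pq = ¬Pq (closed eq Pp xq)
        dual x (just q) xq (+<+ (s≤s ())) | just p | no _ | yes _
        dual x (just q) xq (+<+ (s≤s ())) | just p | no _ | no _

    cover⇒maximum : IsMaximum H M
    cover⇒maximum = M⊆H , λ N N⊆H → ℕ.≮⇒≥ λ M<N →
      weak-duality (injective M) feasible (injective N) (λ _ _ → N⊆H)
        (≡.subst₂ ℤ._<_ (≡.sym (M-value M)) (≡.sym (M-value N)) (+<+ M<N))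

    module _ {N} (N-max : IsMaximum H N) where
      private
        N-optimal : value (mate M) ≤ value (mate N)
        N-optimal N<M with ≡.subst₂ ℤ._<_ (M-value N) (M-value M) N<M
        ... | +<+ n<m = ℕ.<⇒≱ n<m (proj₂ N-max M M⊆H)

        tight : ∀ x → price β (mate N x) ℤ.+ count (mate M x) ≤ price β (mate M x) ℤ.+ count (mate N x)
        tight = slack-applicant (injective M) feasible (injective N) (λ _ _ → proj₁ N-max) N-optimal

        spare : ∀ p → Idle (mate N) p → β p ≤ + 0
        spare = slack-job (injective M) feasible (injective N) (λ _ _ → proj₁ N-max) N-optimal

      -- By slackness the indicator prices serve `N` as well. Concretely, `tight` puts the `M`-mate
      -- of `x` into `P` whenever `x` has an `N`-mate in `P` or none at all; the fields of the cover
      -- for `M` do the rest.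
      cover-transfer : Cover H N P
      cover-transfer = record { decide = decide ; busy = busy′ ; closed = closed′ ; exposed = exposed′ }
        where
        busy′ : ∀ {p} → P p → ∃[ x ] edges N x p
        busy′ {p} Pp with matched? N (inj₂ p)
        ... | yes b = b
        ... | no ¬b = contradiction
                        (≡.subst (+ 0 ℤ.<_) (≡.sym (indicator-yes (decide p) Pp)) (+<+ (s≤s z≤n)))
                        (spare p λ x eq → ¬b (x , eq))
        closed′ : ∀ {x p q} → edges N x p → P p → H x q → P q
        closed′ {x} {p} Nxp Pp xq with mate M x in eq | mate N x | Nxp | tight x
        ... | nothing | _ | ≡.refl | _ = exposed eq xq
        ... | just r  | _ | ≡.refl | t with decide p | decide r
        ...   | no ¬Pp | _      = contradiction Pp ¬Pp
        ...   | yes _  | yes Pr = closed eq Pr xq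
        ...   | yes _  | no _   = contradiction (+<+ (s≤s (s≤s z≤n))) t
        exposed′ : ∀ {x q} → mate N x ≡ nothing → H x q → P q
        exposed′ {x} Nx xq with mate M x in eq | mate N x | Nx | tight x
        ... | nothing | _ | ≡.refl | _ = exposed eq xq
        ... | just r  | _ | ≡.refl | t with decide r
        ...   | yes Pr = closed eq Pr xq
        ...   | no _   = contradiction (+<+ (s≤s z≤n)) t

  module _ {p} {H : Graph 0ℓ} {M} {P : Pred Job p} (M-max : IsMaximum H M) (cover : Cover H M P) where

    cover-critical-job : ∀ {p} → P p → Critical H (inj₂ p)
    cover-critical-job Pp N N-max = Cover.busy (cover-transfer (proj₁ M-max) cover {N} N-max) Pp

    -- A maximum matching missing `x` would have `P` as a cover too, and `exposed` would put the
    -- neighbour `p` into it.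
    cover-critical-applicant : ∀ {x p} → edges M x p → ¬ P p → Critical H (inj₁ x)
    cover-critical-applicant {x} {p} Mxp ¬Pp N N-max with mate N x in eq
    ... | just q  = q , ≡.refl
    ... | nothing = contradiction
      (Cover.exposed (cover-transfer (proj₁ M-max) cover {N} N-max) eq (proj₁ M-max Mxp)) ¬Pp

  -- A maximum matching that hits the critical vertex v still maximises twice the size
  -- minus one for hitting v; optimal prices for this objective separate v.
  module Critical⇒Cover {H : Graph 0ℓ} (H? : ∀ x p → Dec (H x p)) (H⊆list : ∀ {x p} → H x p → p ∈ list x)
                        {M} (M-max : IsMaximum H M) where

    hit : Vertex → Applicant → Maybe Job → ℤ
    hit v        x nothing  = + 0
    hit (inj₁ y) x (just p) = indicator (x ≟ y)
    hit (inj₂ q) x (just p) = indicator (p ≟ q)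

    hit-nonneg : ∀ v x o → + 0 ≤ hit v x o
    hit-nonneg v x nothing (+<+ ())
    hit-nonneg (inj₁ y) x (just p) h with x ≟ y
    hit-nonneg (inj₁ y) x (just p) (+<+ ()) | yes _
    hit-nonneg (inj₁ y) x (just p) (+<+ ()) | no  _
    hit-nonneg (inj₂ q) x (just p) h with p ≟ q
    hit-nonneg (inj₂ q) x (just p) (+<+ ()) | yes _
    hit-nonneg (inj₂ q) x (just p) (+<+ ()) | no  _

    reward : Vertex → Applicant → Maybe Job → ℤ
    reward v x o = (count o ℤ.+ count o) ℤ.- hit v x o

    hits : Vertex → Matching → ℤ
    hits v N = sum λ x → hit v x (mate N x)

    hits-matched : ∀ v N → Matched N v → hits v N ≡ + 1
    hits-matched (inj₁ x) N (p , eq) = ≡.trans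
      (sum-only (λ y → hit (inj₁ x) y (mate N y)) x off)
      (≡.trans (≡.cong (hit (inj₁ x) x) eq) (indicator-yes (x ≟ x) ≡.refl))
      where
      off : ∀ y → y ≢ x → hit (inj₁ x) y (mate N y) ≡ + 0
      off y y≢x with mate N y
      ... | nothing = ≡.refl
      ... | just _  = (indicator-no (y ≟ x) y≢x)
    hits-matched (inj₂ p) N (x , eq) = ≡.trans
      (sum-only (λ y → hit (inj₂ p) y (mate N y)) x off)
      (≡.trans (≡.cong (hit (inj₂ p) x) eq) (indicator-yes (p ≟ p) ≡.refl))
      where
      off : ∀ y → y ≢ x → hit (inj₂ p) y (mate N y) ≡ + 0
      off y y≢x with mate N y in eq′
      ... | nothing = ≡.refl
      ... | just q  = (indicator-no (q ≟ p)
                        λ { ≡.refl → y≢x (injective N y x q eq′ eq) })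

    total : Vertex → Matching → ℤ
    total v N = sum λ x → reward v x (mate N x)

    total≡ : ∀ v N → total v N ℤ.+ hits v N ≡ + (size N ℕ.+ size N)
    total≡ v N = begin
      total v N ℤ.+ hits v N
        ≡⟨ ∑-distrib-+ (λ x → reward v x (mate N x)) (λ x → hit v x (mate N x)) ⟨
      sum (λ x → reward v x (mate N x) ℤ.+ hit v x (mate N x))
        ≡⟨ sum-cong-≗ (λ x → OrderedGroup.x-y+y≈x ℤ-orderedAbelianGroup _ (hit v x (mate N x))) ⟩
      sum (λ x → count (mate N x) ℤ.+ count (mate N x))
        ≡⟨ ∑-distrib-+ (count ∘ mate N) (count ∘ mate N) ⟩
      sum (count ∘ mate N) ℤ.+ sum (count ∘ mate N)
        ≡⟨ ≡.cong₂ ℤ._+_ (sum-count (mate N)) (sum-count (mate N)) ⟩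
      + (size N ℕ.+ size N) ∎
      where open ≡-Reasoning

    open Assignment ℤ-orderedAbelianGroup H using (Injectiveᵐ; Allowed; module Strong; Feasible)

    module _ v (critical : Critical H v) where

      private
        toMatching : ∀ N → Injectiveᵐ (reward v) N → Allowed (reward v) N → Matching
        toMatching N inj allowed = record
          { mate = N ; listed = λ x p eq → H⊆list (allowed x p eq) ; injective = inj }

        -- A maximum `N` hits `v` just as `M` does; a smaller one loses at least two and recovers at
        -- most one by missing `v`.
        total≤ : ∀ N → edges N ⇒ H → total v N ≤ total v M
        total≤ N N⊆H = OrderedGroup.+-cancelʳ-≤ ℤ-orderedAbelianGroup (+ 1) (begin
          total v N ℤ.+ + 1         ≤⟨ bound ⟩
          + (size M ℕ.+ size M)     ≡⟨ total≡ v M ⟨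
          total v M ℤ.+ hits v M    ≡⟨ ≡.cong (λ h → total v M ℤ.+ h) (hits-matched v M (critical M M-max)) ⟩
          total v M ℤ.+ + 1         ∎)
          where
          open ≤-Reasoning
          size≤ : size N ℕ.≤ size M
          size≤ = proj₂ M-max N N⊆H
          bound : total v N ℤ.+ + 1 ≤ + (size M ℕ.+ size M)
          bound with ℕ.m≤n⇒m<n∨m≡n size≤
          ... | inj₂ eq = ≤-reflexive (≡.trans
            (≡.cong (λ h → total v N ℤ.+ h) (≡.sym (hits-matched v N (critical N (N⊆H , λ K K⊆H →
              ≡.subst (size K ℕ.≤_) (≡.sym eq) (proj₂ M-max K K⊆H))))))
            (≡.trans (total≡ v N) (≡.cong (λ s → + (s ℕ.+ s)) eq)))
          ... | inj₁ N<M = begin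
            total v N ℤ.+ + 1
              ≤⟨ +-monoˡ-≤ (+ 1) (OrderedGroup.x≤x+y ℤ-orderedAbelianGroup {total v N} hits≥0) ⟩
            (total v N ℤ.+ hits v N) ℤ.+ + 1
              ≡⟨ ≡.cong (ℤ._+ + 1) (total≡ v N) ⟩
            + (size N ℕ.+ size N) ℤ.+ + 1
              ≤⟨ (λ { (+<+ lt) → ℕ.<⇒≱ lt
                   (ℕ.≤-trans (ℕ.≤-reflexive (ℕ.+-comm _ 1)) (ℕ.+-mono-≤ N<M size≤)) }) ⟩
            + (size M ℕ.+ size M) ∎
            where
            hits≥0 : + 0 ≤ hits v N
            hits≥0 = ≤-trans (≤-reflexive (≡.sym (sum-zero {f = λ (_ : Applicant) → + 0} λ _ → ≡.refl)))
                             (OrderedGroup.sum-mono-≤ ℤ-orderedAbelianGroup λ x → hit-nonneg v x (mate N x))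

      prices : ∃ (Feasible (reward v) (mate M))
      prices = Strong.strong-duality (reward v) H? (injective M) (λ _ _ → proj₁ M-max)
        λ N inj allowed → total≤ (toMatching N inj allowed) (allowed _ _)

    module _ {p : Job} (critical : Critical H (inj₂ p))
             {β} (feasible : Feasible (reward (inj₂ p)) (mate M) β) where
      private
        open Feasible (reward (inj₂ p)) feasible
        open Assignment ℤ-orderedAbelianGroup H (reward (inj₂ p)) using (price; Option)

        dual-at : ∀ x {m} o → mate M x ≡ m → Option x o →
                  price β m ℤ.+ reward (inj₂ p) x o ≤ price β o ℤ.+ reward (inj₂ p) x m
        dual-at x o ≡.refl = dual x o

        here? : Job → ℤ
        here? q = indicator (q ≟ p)

        shift : ∀ a b c d → a ℤ.+ (+ 2 ℤ.- c) ≤ b ℤ.+ (+ 2 ℤ.- d) → a ℤ.+ d ≤ b ℤ.+ c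
        shift a b c d h = +-cancelˡ-≤ (+ 2) (begin
          + 2 ℤ.+ (a ℤ.+ d)                          ≡⟨ left a c d ⟩
          (a ℤ.+ (+ 2 ℤ.- c)) ℤ.+ (c ℤ.+ d)          ≤⟨ +-monoˡ-≤ (c ℤ.+ d) h ⟩
          (b ℤ.+ (+ 2 ℤ.- d)) ℤ.+ (c ℤ.+ d)          ≡⟨ right b c d ⟩
          + 2 ℤ.+ (b ℤ.+ c)                          ∎)
          where
          open ≤-Reasoning
          left : ∀ a c d → + 2 ℤ.+ (a ℤ.+ d) ≡ (a ℤ.+ (+ 2 ℤ.- c)) ℤ.+ (c ℤ.+ d)
          left = solve-∀
          right : ∀ b c d → (b ℤ.+ (+ 2 ℤ.- d)) ℤ.+ (c ℤ.+ d) ≡ + 2 ℤ.+ (b ℤ.+ c)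
          right = solve-∀

        -- Adding the hit back to the prices gives prices for the doubled size alone, and the sum is
        -- positive at `p`. Jobs of positive price form the cover.
        Q : Pred Job 0ℓ
        Q q = + 0 ℤ.< β q ℤ.+ here? q

        Qp : Q p
        Qp = ≡.subst (λ h → + 0 ℤ.< β p ℤ.+ h) (≡.sym (indicator-yes (p ≟ p) ≡.refl))
               (<-≤-trans (+<+ (s≤s z≤n)) (+-monoˡ-≤ (+ 1) (nonneg p)))

        busy′ : ∀ {q} → Q q → ∃[ x ] edges M x q
        busy′ {q} Qq with matched? M (inj₂ q)
        ... | yes b = b
        ... | no ¬b with q ≟ p
        ...   | yes ≡.refl = critical M M-max
        ...   | no  _      = contradiction (≡.subst (+ 0 ℤ.<_) (ℤ.+-identityʳ (β q)) Qq)
                               (idle q λ x eq → ¬b (x , eq))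

        closed′ : ∀ {x q r} → edges M x q → Q q → H x r → Q r
        closed′ {x} {q} {r} eq Qq xr = <-≤-trans Qq (shift (β q) (β r) (here? r) (here? q)
          (dual-at x (just r) eq xr))

        exposed′ : ∀ {x q} → mate M x ≡ nothing → H x q → Q q
        -- An unmatched applicant has reward `+ 0`, that is `+ 2 - + 2`; hence the value `+ 2` in
        -- the place of a hit.
        exposed′ {x} {q} eq xq = <-≤-trans (+<+ (s≤s z≤n)) (shift (+ 0) (β q) (here? q) (+ 2)
          (dual-at x (just q) eq xq))

      job-cover : Σ[ Q ∈ Pred Job 0ℓ ] Cover H M Q × Q p
      job-cover = Q , record
        { decide = λ q → + 0 ℤ.<? β q ℤ.+ here? q
        ; busy = busy′ ; closed = closed′ ; exposed = exposed′ } , Qp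

    module _ {y : Applicant} (critical : Critical H (inj₁ y))
             {β} (feasible : Feasible (reward (inj₁ y)) (mate M) β) where
      private
        open Feasible (reward (inj₁ y)) feasible
        open Assignment ℤ-orderedAbelianGroup H (reward (inj₁ y)) using (price; Option)

        dual-at : ∀ x {m} o → mate M x ≡ m → Option x o →
                  price β m ℤ.+ reward (inj₁ y) x o ≤ price β o ℤ.+ reward (inj₁ y) x m
        dual-at x o ≡.refl = dual x o

        -- The threshold separates two prices: an unmatched applicant would earn `+ 2` from any
        -- neighbouring job, which must therefore cost `+ 2`, while `y` gives up only `+ 1` by
        -- leaving her mate, who therefore costs at most `+ 1`.
        Q : Pred Job 0ℓ
        Q q = + 1 ℤ.< β q

        busy′ : ∀ {q} → Q q → ∃[ x ] edges M x q
        busy′ {q} Qq with matched? M (inj₂ q)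
        ... | yes b = b
        ... | no ¬b = contradiction (ℤ.<-trans (+<+ (s≤s z≤n)) Qq) (idle q λ x eq → ¬b (x , eq))

        closed′ : ∀ {x q r} → edges M x q → Q q → H x r → Q r
        closed′ {x} {q} {r} eq Qq xr = <-≤-trans Qq (OrderedGroup.+-cancelʳ-≤ ℤ-orderedAbelianGroup
          (reward (inj₁ y) x (just r))
          (dual-at x (just r) eq xr))

        exposed′ : ∀ {x q} → mate M x ≡ nothing → H x q → Q q
        exposed′ {x} {q} eq xq = <-≤-trans (+<+ (s≤s (s≤s z≤n))) (begin
          + 2                                      ≡⟨ ≡.cong (λ h → + 2 ℤ.- h) (indicator-no (x ≟ y) x≢y) ⟨
          reward (inj₁ y) x (just q)               ≡⟨ ℤ.+-identityˡ _ ⟨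
          + 0 ℤ.+ reward (inj₁ y) x (just q)       ≤⟨ dual-at x (just q) eq xq ⟩
          β q ℤ.+ + 0                              ≡⟨ ℤ.+-identityʳ (β q) ⟩
          β q                                      ∎)
          where
          open ≤-Reasoning
          x≢y : x ≢ y
          x≢y ≡.refl with critical M M-max
          ... | p , eq′ with ≡.trans (≡.sym eq) eq′
          ...   | ()

      applicant-cover : Σ[ Q ∈ Pred Job 0ℓ ] Cover H M Q × (∀ {p} → edges M y p → ¬ Q p)
      applicant-cover = Q , record
        { decide = λ q → + 1 ℤ.<? β q
        ; busy = busy′ ; closed = closed′ ; exposed = exposed′ } , ¬Q
        where
        open ≤-Reasoning
        ¬Q : ∀ {p} → edges M y p → ¬ Q p
        ¬Q {p} eq = begin
          β p                                  ≡⟨ ℤ.+-identityʳ (β p) ⟨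
          β p ℤ.+ + 0                          ≤⟨ dual-at y nothing eq (lift tt) ⟩
          + 0 ℤ.+ reward (inj₁ y) y (just p)
            ≡⟨ ≡.cong (λ h → + 0 ℤ.+ (+ 2 ℤ.- h)) (indicator-yes (y ≟ y) ≡.refl) ⟩
          + 1                                  ∎

    critical-job⇒cover : ∀ {p} → Critical H (inj₂ p) → Σ[ Q ∈ Pred Job 0ℓ ] Cover H M Q × Q p
    critical-job⇒cover critical = job-cover critical (proj₂ (prices _ critical))

    critical-applicant⇒cover : ∀ {x} → Critical H (inj₁ x) →
                               Σ[ Q ∈ Pred Job 0ℓ ] Cover H M Q × (∀ {p} → edges M x p → ¬ Q p)
    critical-applicant⇒cover critical = applicant-cover critical (proj₂ (prices _ critical))

  -- Decidability of criticality by exhaustive search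

  Mates : Set
  Mates = Applicant → Maybe Job

  Valid : Mates → Set
  Valid f = (∀ x p → f x ≡ just p → p ∈ list x) × (∀ x y p → f x ≡ just p → f y ≡ just p → x ≡ y)

  valid? : ∀ f → Dec (Valid f)
  valid? f = (all? λ x → all? λ p → ≡-dec _≟_ (f x) (just p) →-dec (p ∈? list x)) ×-dec
             (all? λ x → all? λ y → all? λ p →
               ≡-dec _≟_ (f x) (just p) →-dec (≡-dec _≟_ (f y) (just p) →-dec (x ≟ y)))

  valid-resp : ∀ {f g} → f ≗ g → Valid f → Valid g
  valid-resp f≗g (listed , inj) =
    (λ x p eq → listed x p (≡.trans (f≗g x) eq)) ,
    (λ x y p eq eq′ → inj x y p (≡.trans (f≗g x) eq) (≡.trans (f≗g y) eq′))

  fromMates : ∀ f → Valid f → Matching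
  fromMates f (listed , inj) = record { mate = f ; listed = listed ; injective = inj }

  -- Mate functions are coded as elements of a finite power. Decoding recovers them only pointwise
  -- and with new validity proofs, so `P` has to respect pointwise equality of mates.
  matching-search : ∀ {p} {P : Pred Matching p} → Decidable P →
                    (∀ {M N} → mate M ≗ mate N → P M → P N) → Dec (∃ P)
  matching-search {P = P} P? resp = map′ found lost (any? λ k → holds? (decode k))
    where
    toMaybe : ∀ {n} → Fin (ℕ.suc n) → Maybe (Fin n)
    toMaybe zero    = nothing
    toMaybe (suc i) = just i
    fromMaybe : ∀ {n} → Maybe (Fin n) → Fin (ℕ.suc n)
    fromMaybe = maybe′ suc zero
    toMaybe-fromMaybe : ∀ {n} (o : Maybe (Fin n)) → toMaybe (fromMaybe o) ≡ o
    toMaybe-fromMaybe nothing  = ≡.refl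
    toMaybe-fromMaybe (just _) = ≡.refl
    decode : Fin (ℕ.suc #jobs ℕ.^ #applicants) → Mates
    decode k x = toMaybe (finToFun k x)
    Holds : Mates → Set _
    Holds f = Σ[ v ∈ Valid f ] P (fromMates f v)
    holds? : ∀ f → Dec (Holds f)
    holds? f with valid? f
    ... | no ¬v = no (¬v ∘ proj₁)
    ... | yes v = map′ (v ,_) (λ (v′ , h) → resp (λ _ → ≡.refl) h) (P? (fromMates f v))
    found : (∃[ k ] Holds (decode k)) → ∃ P
    found (k , v , h) = fromMates _ v , h
    lost : ∃ P → ∃[ k ] Holds (decode k)
    lost (M , h) = k , valid-resp eq (listed M , injective M) , resp eq h
      where
      k = funToFin (fromMaybe ∘ mate M)
      eq : mate M ≗ decode k
      eq x = ≡.sym (≡.trans (≡.cong toMaybe (finToFun-funToFin (fromMaybe ∘ mate M) x))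
                            (toMaybe-fromMaybe (mate M x)))

  size-resp : ∀ {M N} → mate M ≗ mate N → size M ≡ size N
  size-resp {M} {N} eq = ≡.cong ∣_∣ (tabulate-cong (≡.cong is-just ∘ eq))

  module _ {H : Graph 0ℓ} (H? : ∀ x p → Dec (H x p)) where

    within? : ∀ M → Dec (edges M ⇒ H)
    within? M = map′ (λ h {x} {p} → h x p) (λ h x p → h {x} {p})
                     (all? λ x → all? λ p → ≡-dec _≟_ (mate M x) (just p) →-dec H? x p)

    maximum? : ∀ M → Dec (IsMaximum H M)
    maximum? M = within? M ×-dec map′
      (λ ¬larger N N⊆H → ℕ.≮⇒≥ λ M<N → ¬larger (N , (λ {x} {p} → N⊆H {x} {p}) , M<N))
      (λ max (N , N⊆H , M<N) → ℕ.<⇒≱ M<N (max N N⊆H))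
      (¬? (matching-search (λ N → within? N ×-dec (size M ℕ.<? size N))
        λ {K} {N} eq (K⊆H , M<K) → (λ {x} Nxp → K⊆H (≡.trans (eq x) Nxp)) ,
          ≡.subst (size M ℕ.<_) (size-resp {K} {N} eq) M<K))

    maximum-resp : ∀ {M N} → mate M ≗ mate N → IsMaximum H M → IsMaximum H N
    maximum-resp {M} {N} eq (M⊆H , max) = (λ {x} Nxp → M⊆H (≡.trans (eq x) Nxp)) ,
      λ K K⊆H → ≡.subst (size K ℕ.≤_) (size-resp {M} {N} eq) (max K K⊆H)

    critical? : ∀ v → Dec (Critical H v)
    critical? v = map′
      (λ ¬miss M M-max → decidable-stable (matched? M v) λ ¬m → ¬miss (M , M-max , ¬m))
      (λ critical (M , M-max , ¬m) → ¬m (critical M M-max))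
      (¬? (matching-search (λ M → maximum? M ×-dec ¬? (matched? M v))
        λ {M} {N} eq (M-max , ¬m) → maximum-resp {M} {N} eq M-max ,
          λ m → ¬m (matched-resp {N} {M} (λ x → ≡.sym (eq x)) v m)))
      where
      matched-resp : ∀ {M N} → mate M ≗ mate N → ∀ v → Matched M v → Matched N v
      matched-resp eq (inj₁ x) (p , m) = p , ≡.trans (≡.sym (eq x)) m
      matched-resp eq (inj₂ p) (x , m) = x , ≡.trans (≡.sym (eq x)) m

  highest? : ∀ {P : Pred Job 0ℓ} → Decidable P → ∀ x p → Dec (Highest P x p)
  highest? P? x p = (p ∈? list x) ×-dec P? p ×-dec
    all? λ q → (q ∈? list x) →-dec (P? q →-dec (rank x p ℕ.≤? rank x q))

  mutual
    G? : ∀ i x p → Dec (G i x p)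
    G? ℕ.zero    x p = no id
    G? (ℕ.suc i) x p = G? i x p ⊎-dec
      ((toℕ (category x) ℕ.≟ i) ×-dec highest? (nonCritical? i) x p)

    nonCritical? : ∀ i → Decidable (NonCriticalUpTo i)
    nonCritical? ℕ.zero    p = yes tt
    nonCritical? (ℕ.suc i) p = nonCritical? i p ×-dec ¬? (critical? (G? (ℕ.suc i)) (inj₂ p))

-- The graphs G_i and the labels

module Stages {c ℓ₁ ℓ₂} {W : OrderedAbelianGroup c ℓ₁ ℓ₂} (I : Instance W) where
  open OrderedAbelianGroup W
  open Instance I
  open PopularMatching I
  open Covers I
  open OrderedGroup W
  open Supremum _<_

  -- The set `A` may contain idle jobs, as a price threshold of `0#` does; that all jobs of the
  -- intersection are matched comes from `P`.
  cover-∩ : ∀ {a p} {H M} {A : Pred Job a} {P : Pred Job p} → Decidable A →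
            (∀ {x p q} → edges M x p → A p → H x p → H x q → A q) →
            (∀ {x q} → mate M x ≡ nothing → H x q → A q) →
            edges M ⇒ H → Cover H M P → Cover H M (λ p → A p × P p)
  cover-∩ A? A-closed A-exposed M⊆H cover = record
    { decide  = λ p → A? p ×-dec decide p
    ; busy    = busy ∘ proj₂
    ; closed  = λ Mxp (Ap , Pp) xq → A-closed Mxp Ap (M⊆H Mxp) xq , closed Mxp Pp xq
    ; exposed = λ free xq → A-exposed free xq , exposed free xq
    }
    where open Cover cover

  -- This is how a given path is exploited: by `closed`, a cover follows it from its first job to
  -- the mate of `z`.
  altPath-cover : ∀ {a H M} {P : Pred Job a} {z p ps xs} → Cover H M P → AltPath H M z p ps xs → P p →
                  ∃[ q ] edges M z q × P q
  altPath-cover cover (end _ Mzp)            Pp = _ , Mzp , Pp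
  altPath-cover cover (step _ Mxp xp′ _ path) Pp =
    altPath-cover cover path (Cover.closed cover Mxp Pp xp′)

  G-listed : ∀ i {x p} → G i x p → p ∈ list x
  G-listed (ℕ.suc i) (inj₁ xp)           = G-listed i xp
  G-listed (ℕ.suc i) (inj₂ (_ , p∈ , _)) = p∈

  G⇒First : ∀ i {x p} → G i x p → toℕ (category x) ℕ.< i × First x p
  G⇒First (ℕ.suc i) (inj₁ xp)             = let c<i , h = G⇒First i xp in ℕ.m<n⇒m<1+n c<i , h
  G⇒First (ℕ.suc i) (inj₂ (≡.refl , h)) = ℕ.n<1+n _ , h

  First⇒G : ∀ i {x p} → toℕ (category x) ℕ.< i → First x p → G i x p
  First⇒G (ℕ.suc i) c<1+i h with ℕ.m≤n⇒m<n∨m≡n (ℕ.≤-pred c<1+i)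
  ... | inj₁ c<i    = inj₁ (First⇒G i c<i h)
  ... | inj₂ ≡.refl = inj₂ (≡.refl , h)

  Gᶜ⇒First : ∀ i {x p} → Gᶜ i x p → toℕ (category x) ℕ.≤ toℕ i × First x p
  Gᶜ⇒First i xp = let c<i , h = G⇒First (ℕ.suc (toℕ i)) xp in ℕ.≤-pred c<i , h

  First⇒Gᶜ : ∀ i {x p} → toℕ (category x) ℕ.≤ toℕ i → First x p → Gᶜ i x p
  First⇒Gᶜ i c≤i = First⇒G (ℕ.suc (toℕ i)) (s≤s c≤i)

  Gᶜ? : ∀ i x p → Dec (Gᶜ i x p)
  Gᶜ? i = G? (ℕ.suc (toℕ i))

  first? : ∀ x → Decidable (First x)
  first? x = highest? (nonCritical? (toℕ (category x))) x

  criticalᶜ? : ∀ i v → Dec (Critical (Gᶜ i) v)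
  criticalᶜ? i = critical? (Gᶜ? i)

  second? : ∀ x → Decidable (Second x)
  second? x p = ¬? (criticalᶜ? (category x) (inj₁ x)) ×-dec highest? (nonCritical? _) x p

  nonCritical-≤ : ∀ {i j p} → i ℕ.≤ j → NonCriticalUpTo j p → NonCriticalUpTo i p
  nonCritical-≤ {i} {j} i≤j h with ℕ.m≤n⇒m<n∨m≡n i≤j
  ... | inj₂ ≡.refl = h
  nonCritical-≤ {i} {ℕ.suc j} _ (h , _) | inj₁ i<1+j = nonCritical-≤ (ℕ.≤-pred i<1+j) h

  nonCritical-< : ∀ i {j p} → toℕ i ℕ.< j → NonCriticalUpTo j p → ¬ Critical (Gᶜ i) (inj₂ p)
  nonCritical-< i i<j h = proj₂ (nonCritical-≤ i<j h)

  newlyCritical : ∀ j {p} → j ℕ.≤ #categories → ¬ NonCriticalUpTo j p →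
                  ∃[ i ] toℕ i ℕ.< j × NewlyCritical i p
  newlyCritical ℕ.zero    _   h = contradiction tt h
  newlyCritical (ℕ.suc j) {p} j<K h with nonCritical? j p
  ... | no ¬nc = let i , i<j , new = newlyCritical j (ℕ.<⇒≤ j<K) ¬nc in i , ℕ.m<n⇒m<1+n i<j , new
  ... | yes nc = i , ℕ.≤-reflexive (≡.cong ℕ.suc i≡j) ,
                 ≡.subst (λ j → NonCriticalUpTo j p) (≡.sym i≡j) nc ,
                 ≡.subst (λ j → Critical (G (ℕ.suc j)) (inj₂ p)) (≡.sym i≡j)
                   (decidable-stable (critical? (G? (ℕ.suc j)) (inj₂ p)) λ ¬crit → h (nc , ¬crit))
    where
    i = fromℕ< j<K
    i≡j = toℕ-fromℕ< j<K

  newlyCritical-unique : ∀ {i j p} → NewlyCritical i p → NewlyCritical j p → toℕ i ≡ toℕ j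
  newlyCritical-unique {i} {j} (nc , crit) (nc′ , crit′) with ℕ.<-cmp (toℕ i) (toℕ j)
  ... | tri< i<j _ _ = contradiction crit (nonCritical-< i i<j nc′)
  ... | tri≈ _ i≡j _ = i≡j
  ... | tri> _ _ j<i = contradiction crit′ (nonCritical-< j j<i nc)

  highest-exists : ∀ {P : Pred Job 0ℓ} → Decidable P → ∀ x p → p ∈ list x → P p → ∃ (Highest P x)
  highest-exists {P} P? x p p∈ Pp = go p (ℕ.<-wellFounded (rank x p)) p∈ Pp
    where
    go : ∀ p → Acc ℕ._<_ (rank x p) → p ∈ list x → P p → ∃ (Highest P x)
    go p (acc rec) p∈ Pp with any? (λ q → (q ∈? list x) ×-dec P? q ×-dec (rank x q ℕ.<? rank x p))
    ... | yes (q , q∈ , Pq , q<p) = go q (rec q<p) q∈ Pq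
    ... | no none = p , p∈ , Pp , λ q q∈ Pq → ℕ.≮⇒≥ λ q<p → none (q , q∈ , Pq , q<p)

  Better : Applicant → Pred Job 0ℓ
  Better x q = q ∈ list x × (∀ p → First x p → rank x q ℕ.< rank x p)

  Tied : Applicant → Pred Job 0ℓ
  Tied x q = q ∈ list x × ¬ First x q × (∀ p → First x p → rank x q ≡ rank x p)

  -- A job ranked this high and not yet critical would itself be a first job.
  higher⇒newlyCritical : ∀ {x p q} → First x p → q ∈ list x → rank x q ℕ.≤ rank x p → ¬ First x q →
                         ∃[ i ] toℕ i ℕ.< toℕ (category x) × NewlyCritical i q
  higher⇒newlyCritical {x} {p} {q} (p∈ , _ , p-min) q∈ q≤p ¬first =
    newlyCritical (toℕ (category x)) (ℕ.<⇒≤ (toℕ<n (category x))) λ nc →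
      ¬first (q∈ , nc , λ q′ q′∈ nc′ → ℕ.≤-trans q≤p (p-min q′ q′∈ nc′))

  First-rank : ∀ {x p q} → First x p → First x q → rank x p ≡ rank x q
  First-rank (p∈ , nc , p-min) (q∈ , nc′ , q-min) = ℕ.≤-antisym (p-min _ q∈ nc′) (q-min _ p∈ nc)

  better : ∀ {x p q} → First x p → q ∈ list x → rank x q ℕ.< rank x p → Better x q
  better {x} {q = q} fp q∈ q<p = q∈ , λ p′ fp′ → ≡.subst (rank x q ℕ.<_) (First-rank fp fp′) q<p

  tied : ∀ {x p q} → First x p → ¬ First x q → q ∈ list x → rank x q ≡ rank x p → Tied x q
  tied fp ¬fq q∈ q≡p = q∈ , ¬fq , λ p′ fp′ → ≡.trans q≡p (First-rank fp fp′)

  weight-≤ : ∀ {i j} → toℕ i ℕ.≤ toℕ j → weight j ≤ weight i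
  weight-≤ {i} {j} i≤j with ℕ.m≤n⇒m<n∨m≡n i≤j
  ... | inj₁ i<j = <⇒≤ (weight-decreasing i j i<j)
  ... | inj₂ i≡j = ≤-reflexive (reflexive (≡.cong weight (≡.sym (toℕ-injective i≡j))))

  _≮⁺_ : Carrier ⁺ → Carrier ⁺ → Set (c ⊔ ℓ₂)
  u ≮⁺ v = ¬ (u <⁺ v)

  ≮⁺⇒≤ : ∀ {a b} → [ a ] ≮⁺ [ b ] → b ≤ a
  ≮⁺⇒≤ h a<b = h [ a<b ]

  min-exists : ∀ {q k} {Q : Pred (Fin k) q} → Decidable Q → (l : Fin k → Carrier ⁺) →
               ∃[ v ] (∀ i → Q i → l i ≮⁺ v) × ((∃[ i ] Q i × v ≡ l i) ⊎ v ≡ ⊤⁺)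
  min-exists {k = ℕ.zero}  Q? l = ⊤⁺ , (λ ()) , inj₂ ≡.refl
  min-exists {k = ℕ.suc k} Q? l with min-exists (Q? ∘ suc) (l ∘ suc)
  ... | v , v-lower , v-attained with Q? zero | <⁺-dec _<?_ (l zero) v
  ...   | yes Q0 | yes l0<v = l zero ,
          (λ { zero _ l0<l0 → irrefl l0<l0 ; (suc i) Qi li<l0 → v-lower i Qi (<⁺-trans <-trans li<l0 l0<v) }) ,
          inj₁ (zero , Q0 , ≡.refl)
    where
    irrefl : ∀ {v} → v ≮⁺ v
    irrefl [ v<v ] = <-irrefl refl v<v
  ...   | yes Q0 | no l0≮v = v ,
          (λ { zero _ → l0≮v ; (suc i) → v-lower i }) ,
          [ (λ (i , Qi , eq) → inj₁ (suc i , Qi , eq)) , inj₂ ]′ v-attained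
  ...   | no ¬Q0 | _ = v ,
          (λ { zero Q0 → contradiction Q0 ¬Q0 ; (suc i) → v-lower i }) ,
          [ (λ (i , Qi , eq) → inj₁ (suc i , Qi , eq)) , inj₂ ]′ v-attained

  lambdaMin : ∀ l x {X : Pred Job 0ℓ} → Decidable X → ∃ (IsLambdaMin l x X)
  lambdaMin l x X? =
    let v , lower , attained = min-exists
          (λ q → (q ∈? list x) ×-dec all? (λ p → X? p →-dec (rank x q ℕ.<? rank x p))) l
    in v , (λ { _ (q , q∈ , above , ≡.refl) → lower q (q∈ , above) }) ,
       [ (λ (q , (q∈ , above) , eq) → inj₁ (q , q∈ , above , eq)) , inj₂ ]′ attained

  lambdaEquiv : ∀ l x → ∃ (IsLambdaEquiv l x)
  lambdaEquiv l x =
    let v , lower , attained = min-exists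
          (λ q → (q ∈? list x) ×-dec ¬? (first? x q) ×-dec
                 all? (λ p → first? x p →-dec (rank x q ℕ.≟ rank x p))) l
    in v , (λ { _ (q , q∈ , ¬f , same , ≡.refl) → lower q (q∈ , ¬f , same) }) ,
       [ (λ (q , (q∈ , ¬f , same) , eq) → inj₁ (q , q∈ , ¬f , same , eq)) , inj₂ ]′ attained

  not-below : ∀ {ℓ} {T : Pred (Carrier ⁺) ℓ} {v a b} → IsMin T v → ¬ (v <⁺ [ b ]) → T [ a ] → b ≤ a
  not-below {v = [ v ]} (lower , _) v≮b Ta =
    ≤-trans (≮⁺⇒≤ v≮b) (≮⁺⇒≤ (lower _ Ta))
  not-below {v = ⊤⁺}    (lower , _) _   Ta = contradiction [ _ ]<⊤⁺ (lower _ Ta)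

  module Labels (r : Run) where
    open Run r

    -- A critical job is matched in the maximum matching supplied by the run, but this job is listed
    -- by `x` alone, who has no edges in the earlier graphs.
    lastResort-nonCritical : ∀ x j → j ℕ.≤ toℕ (category x) → NonCriticalUpTo j (lastResort x)
    lastResort-nonCritical x ℕ.zero    _   = tt
    lastResort-nonCritical x (ℕ.suc j) j<c =
      lastResort-nonCritical x j (ℕ.<⇒≤ j<c) , λ crit →
        let y , Ny = crit (chosen i (lastResort x)) max
            y∈     = proj₁ max Ny
        in ℕ.<⇒≱ j<c (ℕ.≤-pred (≡.subst (λ z → toℕ (category z) ℕ.< ℕ.suc j)
             (lastResort-own x y (G-listed (ℕ.suc j) y∈)) (proj₁ (G⇒First (ℕ.suc j) y∈))))
      where
      i = fromℕ< (ℕ.<-trans j<c (toℕ<n (category x)))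
      max : IsMaximum (G (ℕ.suc j)) (chosen i (lastResort x))
      max = ≡.subst (λ j → IsMaximum (G (ℕ.suc j)) (chosen i (lastResort x))) (toℕ-fromℕ< _)
              (chosen-maximum i (lastResort x))

    first-exists : ∀ x → ∃ (First x)
    first-exists x = highest-exists (nonCritical? _) x (lastResort x) (lastResort-listed x)
                       (lastResort-nonCritical x _ ℕ.≤-refl)

    -- Unlabelled jobs get 0#, the only possible price of a job that is never critical.
    label : Job → Carrier
    label p = maybe′ id 0# (labels #categories p)

    -- A job is newly critical at one stage only, so all later stages keep its label.
    labels-stable : ∀ i p → NewlyCritical i p → ∀ j → toℕ i ℕ.< j → j ℕ.≤ #categories →
                    labels j p ≡ labels (ℕ.suc (toℕ i)) p
    labels-stable i p new (ℕ.suc j) i<1+j j<K with ℕ.m≤n⇒m<n∨m≡n (ℕ.≤-pred i<1+j)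
    ... | inj₂ ≡.refl = ≡.refl
    ... | inj₁ i<j    = ≡.trans keep (labels-stable i p new j i<j (ℕ.<⇒≤ j<K))
      where
      keep : labels (ℕ.suc j) p ≡ labels j p
      keep = ≡.subst (λ j → labels (ℕ.suc j) p ≡ labels j p) (toℕ-fromℕ< j<K)
        (labels-keep (fromℕ< j<K) p λ new′ →
          ℕ.<⇒≢ i<j (≡.trans (newlyCritical-unique new new′) (toℕ-fromℕ< j<K)))

    label-finite : ∀ i p → NewlyCritical i p → ∃[ a ] labels (ℕ.suc (toℕ i)) p ≡ [ a ]
    label-finite i p new with toℕ i ℕ.≟ 0
    ... | yes i≡0 = weight i , labels-first i p i≡0 new
    ... | no  i≢0 with labels (ℕ.suc (toℕ i)) p | labels-later i p (ℕ.n≢0⇒n>0 i≢0) new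
    ...   | [ a ] | _         = a , ≡.refl
    ...   | ⊤⁺    | lower , _ = contradiction [ weight i ]<⊤⁺ (lower _ own)

    labelled : ∀ i p → NewlyCritical i p → ∀ j → toℕ i ℕ.< j → j ℕ.≤ #categories →
               labels j p ≡ [ label p ]
    labelled i p new j i<j j≤K
      rewrite labels-stable i p new j i<j j≤K
            | labels-stable i p new #categories (toℕ<n i) ℕ.≤-refl
      with labels (ℕ.suc (toℕ i)) p | label-finite i p new
    ... | [ a ] | _ = ≡.refl

    labelled-suc : ∀ i p → NewlyCritical i p → labels (ℕ.suc (toℕ i)) p ≡ [ label p ]
    labelled-suc i p new = labelled i p new _ (ℕ.n<1+n _) (toℕ<n i)

    unlabelled : ∀ p j → j ℕ.≤ #categories → NonCriticalUpTo j p → labels j p ≡ ⊤⁺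
    unlabelled p ℕ.zero    _   _         = labels-start p
    unlabelled p (ℕ.suc j) j<K (nc , ¬c) =
      ≡.trans (≡.subst (λ j → labels (ℕ.suc j) p ≡ labels j p) (toℕ-fromℕ< j<K)
        (labels-keep (fromℕ< j<K) p λ (_ , crit) →
          ¬c (≡.subst (λ j → Critical (G (ℕ.suc j)) (inj₂ p)) (toℕ-fromℕ< j<K) crit)))
      (unlabelled p j (ℕ.<⇒≤ j<K) nc)

    label-zero : ∀ p → NonCriticalUpTo #categories p → label p ≡ 0#
    label-zero p nc = ≡.cong (maybe′ id 0#) (unlabelled p #categories ℕ.≤-refl nc)

    better-critical : ∀ {x q} → Better x q → ∃[ i ] toℕ i ℕ.< toℕ (category x) × NewlyCritical i q
    better-critical {x} {q} (q∈ , above) = let p , fp = first-exists x in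
      higher⇒newlyCritical fp q∈ (ℕ.<⇒≤ (above p fp)) λ fq → ℕ.<-irrefl ≡.refl (above q fq)

    tied-critical : ∀ {x q} → Tied x q → ∃[ i ] toℕ i ℕ.< toℕ (category x) × NewlyCritical i q
    tied-critical {x} {q} (q∈ , ¬fq , same) = let p , fp = first-exists x in
      higher⇒newlyCritical fp q∈ (ℕ.≤-reflexive (same p fp)) ¬fq

    better-label : ∀ {x q} → Better x q → ∀ i → toℕ (category x) ℕ.≤ toℕ i → labels (toℕ i) q ≡ [ label q ]
    better-label b i c≤i = let j , j<c , new = better-critical b in
      labelled j _ new (toℕ i) (ℕ.<-≤-trans j<c c≤i) (ℕ.<⇒≤ (toℕ<n i))

    tied-label : ∀ {x q} → Tied x q → ∀ i → toℕ (category x) ℕ.≤ toℕ i → labels (toℕ i) q ≡ [ label q ]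
    tied-label t i c≤i = let j , j<c , new = tied-critical t in
      labelled j _ new (toℕ i) (ℕ.<-≤-trans j<c c≤i) (ℕ.<⇒≤ (toℕ<n i))

    private
      later : ∀ i p → 0 ℕ.< toℕ i → NewlyCritical i p →
              IsMin (Candidate (labels (toℕ i)) i (chosen i p) p) [ label p ]
      later i p 0<i new = ≡.subst (IsMin _) (labelled-suc i p new) (labels-later i p 0<i new)

    label≤weight : ∀ i {p} → NewlyCritical i p → label p ≤ weight i
    label≤weight i {p} new with toℕ i ℕ.≟ 0
    ... | yes i≡0 = ≤-reflexive (reflexive (just-injective
                      (≡.trans (≡.sym (labelled-suc i p new)) (labels-first i p i≡0 new))))
    ... | no  i≢0 = ≮⁺⇒≤ (proj₁ (later i p (ℕ.n≢0⇒n>0 i≢0) new) _ own)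

    critical⇒category : ∀ i {x} → Job → Critical (Gᶜ i) (inj₁ x) → toℕ (category x) ℕ.≤ toℕ i
    critical⇒category i p crit = let max = chosen-maximum i p in
      proj₁ (Gᶜ⇒First i (proj₁ max (proj₂ (crit (chosen i p) max))))

    Reaches : Category → Job → Applicant → Set
    Reaches i p x = Critical (Gᶜ i) (inj₁ x) × SimpleAltPath (Gᶜ i) (chosen i p) p x

    -- The job `q` became critical before the category of `x`. So it carries its final label at
    -- stage `i`, and `i` is not the first stage, which means that the label of `p` is a minimum
    -- over candidates.
    label-better : ∀ i {p x q} → NewlyCritical i p → Reaches i p x → Better x q →
                   label p + w x ≤ label q
    label-better i {p} {x} {q} new (crit , path) b@(q∈ , above) = bound (lambdaMin _ x (first? x))
      where
      c≤i = critical⇒category i p crit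
      0<i : 0 ℕ.< toℕ i
      0<i = ℕ.≤-<-trans z≤n (ℕ.<-≤-trans (proj₁ (proj₂ (better-critical b))) c≤i)
      bound : ∃ (IsLambdaMin (labels (toℕ i)) x (First x)) → label p + w x ≤ label q
      bound (⊤⁺ , lower , _) = contradiction
        (≡.subst (_<⁺ ⊤⁺) (≡.sym (better-label b i c≤i)) [ _ ]<⊤⁺) (lower _ (q , q∈ , above , ≡.refl))
      bound ([ v ] , isMin@(lower , _)) = ≤-trans
        (≤-⇒+≤ (≮⁺⇒≤ (proj₁ (later i p 0<i new) _ (min crit path isMin))))
        (≮⁺⇒≤ (lower _ (q , q∈ , above , ≡.sym (better-label b i c≤i))))

    label-tied : ∀ i {p x q} → NewlyCritical i p → Reaches i p x → Tied x q → label p ≤ label q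
    label-tied i {p} {x} {q} new (crit , path) t@(q∈ , ¬f , same) = bound (lambdaEquiv _ x)
      where
      c≤i = critical⇒category i p crit
      0<i : 0 ℕ.< toℕ i
      0<i = ℕ.≤-<-trans z≤n (ℕ.<-≤-trans (proj₁ (proj₂ (tied-critical t))) c≤i)
      bound : ∃ (IsLambdaEquiv (labels (toℕ i)) x) → label p ≤ label q
      bound (v , isMin) =
        not-below isMin (proj₁ (later i p 0<i new) _ (equiv crit path isMin))
          (q , q∈ , ¬f , same , ≡.sym (tied-label t i c≤i))

    -- Records which candidate realises the minimum, in terms of final labels; the converse bounds
    -- are `label≤weight`, `label-better` and `label-tied`.
    data Attained (i : Category) (p : Job) : Set (c ⊔ ℓ₂) where
      weight-attained : weight i ≤ label p → Attained i p
      better-attained : ∀ {x q} → Reaches i p x → Better x q → label q ≤ label p + w x → Attained i p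
      tied-attained   : ∀ {x q} → Reaches i p x → Tied x q → label q ≤ label p → Attained i p

    label-attained : ∀ i {p} → NewlyCritical i p → Attained i p
    label-attained i {p} new with toℕ i ℕ.≟ 0
    ... | yes i≡0 = weight-attained (≤-reflexive (reflexive (just-injective
                      (≡.trans (≡.sym (labels-first i p i≡0 new)) (labelled-suc i p new)))))
    ... | no  i≢0 with proj₂ (later i p (ℕ.n≢0⇒n>0 i≢0) new)
    ...   | inj₁ candidate = attained candidate ≡.refl
      where
      attained : ∀ {u} → Candidate (labels (toℕ i)) i (chosen i p) p u → u ≡ [ label p ] → Attained i p
      attained own eq = weight-attained (≤-reflexive (reflexive (just-injective eq)))
      attained (min {v = [ v ]} crit path (_ , inj₁ (q , q∈ , above , v≡))) eq =
        better-attained (crit , path) (q∈ , above) (-≤⇒≤+ (≤-reflexive (trans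
          (+-congʳ (reflexive (just-injective (≡.trans (≡.sym (better-label (q∈ , above) i
            (critical⇒category i p crit))) (≡.sym v≡))))) (reflexive (just-injective eq)))))
      attained (min {v = ⊤⁺} _ _ _) ()
      attained (equiv crit path (_ , inj₁ (q , q∈ , ¬f , same , v≡))) eq =
        tied-attained (crit , path) (q∈ , ¬f , same) (≤-reflexive (reflexive (just-injective
          (≡.trans (≡.sym (tied-label (q∈ , ¬f , same) i (critical⇒category i p crit)))
            (≡.trans (≡.sym v≡) eq)))))
      attained (equiv _ _ (_ , inj₂ ≡.refl)) ()

    unreturned-better : ¬ ReturnsNoPopularMatching r → ∀ {x q} → Better x q → w x ≤ label q
    unreturned-better ¬stop {x} {q} b@(q∈ , above) =
      let v , isMin = lambdaMin (labels (toℕ (category x))) x (first? x) in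
      not-below isMin
        (λ v<w → ¬stop (category x , x ,
          ℕ.≤-<-trans z≤n (proj₁ (proj₂ (better-critical b))) , ≡.refl , v , isMin , v<w))
        (q , q∈ , above , ≡.sym (better-label b (category x) ℕ.≤-refl))

    module _ {x p} (unpruned : ¬ Pruned r x p) where

      unpruned-better : First x p → ∀ i → toℕ (category x) ℕ.≤ toℕ i → ¬ Critical (Gᶜ i) (inj₁ x) →
                        ∀ {q} → Better x q → w x + weight i ≤ label q
      unpruned-better fp i c≤i ¬crit {q} b@(q∈ , above) =
        let v , isMin = lambdaMin (labels (toℕ i)) x (first? x) in
        not-below isMin
          (λ v<w → unpruned (first i (ℕ.≤-<-trans z≤n (ℕ.<-≤-trans (proj₁ (proj₂ (better-critical b))) c≤i))
            c≤i ¬crit (inj₁ (v , isMin , v<w)) fp))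
          (q , q∈ , above , ≡.sym (better-label b i c≤i))

      unpruned-tied : First x p → ∀ i → toℕ (category x) ℕ.≤ toℕ i → ¬ Critical (Gᶜ i) (inj₁ x) →
                      ∀ {q} → Tied x q → weight i ≤ label q
      unpruned-tied fp i c≤i ¬crit {q} t@(q∈ , ¬f , same) =
        let v , isMin = lambdaEquiv (labels (toℕ i)) x in
        not-below isMin
          (λ v<w → unpruned (first i (ℕ.≤-<-trans z≤n (ℕ.<-≤-trans (proj₁ (proj₂ (tied-critical t))) c≤i))
            c≤i ¬crit (inj₂ (v , isMin , v<w)) fp))
          (q , q∈ , ¬f , same , ≡.sym (tied-label t i c≤i))

      unpruned-second : Second x p → ∀ {q} → q ∈ list x → rank x q ℕ.< rank x p → w x ≤ label q
      unpruned-second sp@(_ , p∈ , nc , p-min) {q} q∈ q<p =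
        let i , _ , new   = newlyCritical _ (toℕ<n (category x)) λ ncq → ℕ.<⇒≱ q<p (p-min q q∈ ncq)
            v , isMin     = lambdaMin (labels #categories) x (second? x)
        in not-below isMin (λ v<w → unpruned (second (v , isMin , v<w) sp))
             (q , q∈ , (λ p′ (_ , p′∈ , nc′ , _) → ℕ.<-≤-trans q<p (p-min p′ p′∈ nc′)) ,
              ≡.sym (labelled i q new _ (toℕ<n i) ℕ.≤-refl))

-- Popularity as optimality

module Votes {c ℓ₁ ℓ₂} {W : OrderedAbelianGroup c ℓ₁ ℓ₂} (I : Instance W)
             (M : PopularMatching.Matching I) where
  open OrderedAbelianGroup W
  open Instance I
  open PopularMatching I
  open OrderedGroup W

  open import Algebra.Properties.AbelianGroup abelianGroup using (ε⁻¹≈ε)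

  ballot : Applicant → Maybe Job → Maybe Job → Carrier
  ballot x a b = if does (prefers? x a b) then w x else 0#

  vote : Applicant → Maybe Job → Carrier
  vote x o = ballot x o (mate M x) - ballot x (mate M x) o

  ballot-yes : ∀ {x a b} → Prefers x a b → ballot x a b ≡ w x
  ballot-yes {x} {a} {b} h = ≡.cong (if_then w x else 0#) (dec-true (prefers? x a b) h)

  ballot-no : ∀ {x a b} → ¬ Prefers x a b → ballot x a b ≡ 0#
  ballot-no {x} {a} {b} h = ≡.cong (if_then w x else 0#) (dec-false (prefers? x a b) h)

  vote-for : ∀ {x o m} → mate M x ≡ m → Prefers x o m → ¬ Prefers x m o → vote x o ≈ w x
  vote-for {x} ≡.refl o>m m≯o rewrite ballot-yes {x} o>m | ballot-no {x} m≯o =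
    trans (+-congˡ ε⁻¹≈ε) (+-identityʳ _)

  vote-against : ∀ {x o m} → mate M x ≡ m → ¬ Prefers x o m → Prefers x m o → vote x o ≈ - w x
  vote-against {x} ≡.refl o≯m m>o rewrite ballot-no {x} o≯m | ballot-yes {x} m>o = +-identityˡ _

  vote-abstain : ∀ {x o m} → mate M x ≡ m → ¬ Prefers x o m → ¬ Prefers x m o → vote x o ≈ 0#
  vote-abstain {x} ≡.refl o≯m m≯o rewrite ballot-no {x} o≯m | ballot-no {x} m≯o = +-inverseʳ 0#

  prefers-irrefl : ∀ x o → ¬ Prefers x o o
  prefers-irrefl x (just p) h = ℕ.<-irrefl ≡.refl h

  vote-self : ∀ x → vote x (mate M x) ≈ 0#
  vote-self x = vote-abstain ≡.refl (prefers-irrefl x (mate M x)) (prefers-irrefl x (mate M x))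

  open Assignment W (λ x p → p ∈ list x) vote public

  value≈satisfaction : ∀ N → value (mate N) ≈ satisfaction N M
  value≈satisfaction N = trans
    (∑-distrib-+ (λ x → ballot x (mate N x) (mate M x)) (λ x → - ballot x (mate M x) (mate N x)))
    (+-congˡ (sum-neg λ x → ballot x (mate M x) (mate N x)))

  value-self : value (mate M) ≈ 0#
  value-self = sum-zero vote-self

  popular⇒prices : Popular M → ∃ (Feasible (mate M))
  popular⇒prices popular = Strong.strong-duality (λ x p → p ∈? list x) (injective M) (listed M)
    λ N inj allowed M<N → let N′ = record { mate = N ; listed = allowed ; injective = inj } in
      popular (N′ , <-respˡ-≈ value-self (<-respʳ-≈ (value≈satisfaction N′) M<N))

  prices⇒popular : ∀ {β} → Feasible (mate M) β → Popular M
  prices⇒popular feasible (N , N-better) =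
    weak-duality (injective M) feasible (injective N) (listed N)
      (<-respˡ-≈ (sym value-self) (<-respʳ-≈ (sym (value≈satisfaction N)) N-better))

-- The matching M ∩ E[H]

module Restriction {c ℓ₁ ℓ₂} {W : OrderedAbelianGroup c ℓ₁ ℓ₂} (I : Instance W) where
  open Instance I
  open PopularMatching I

  module _ {H : Graph 0ℓ} (H? : ∀ x p → Dec (H x p)) (M : Matching) where

    keep : Applicant → Maybe Job → Maybe Job
    keep x nothing  = nothing
    keep x (just p) = if does (H? x p) then just p else nothing

    keep⁻ : ∀ x o {p} → keep x o ≡ just p → o ≡ just p × H x p
    keep⁻ x (just q) eq with H? x q
    keep⁻ x (just q) ≡.refl | yes xq = ≡.refl , xq

    restrict : Matching
    restrict = record
      { mate      = λ x → keep x (mate M x)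
      ; listed    = λ x p eq → listed M x p (proj₁ (keep⁻ x _ eq))
      ; injective = λ x y p eq eq′ → injective M x y p (proj₁ (keep⁻ x _ eq)) (proj₁ (keep⁻ y _ eq′))
      }

    restrict⁺ : ∀ {x p} → edges M x p → H x p → edges restrict x p
    restrict⁺ {x} {p} eq xp rewrite eq | dec-true (H? x p) xp = ≡.refl

    restrict-edges : edges restrict ⇔ᵍ (edges M ∩ H)
    restrict-edges = (λ {x} → keep⁻ x (mate M x)) , λ (eq , xp) → restrict⁺ eq xp

-- Prices of a popular matching

module FromPopular {c ℓ₁ ℓ₂} {W : OrderedAbelianGroup c ℓ₁ ℓ₂} (I : Instance W)
                   (r : PopularMatching.Run I) (M : PopularMatching.Matching I)
                   {β} (feasible : Votes.Feasible I M (PopularMatching.Matching.mate M) β) where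
  open OrderedAbelianGroup W
  open Instance I
  open PopularMatching I
  open Covers I
  open Stages I
  open Labels r
  open Restriction I
  open OrderedGroup W
  open Votes I M using (vote; vote-for; vote-against; vote-abstain; vote-self; price; module Feasible)
  open Feasible feasible
  open Supremum _<_
  open ≤-Reasoning

  private
    exchange : ∀ x {m o v} → mate M x ≡ m → vote x o ≈ v →
               (∀ p → o ≡ just p → p ∈ list x) → price β m + v ≤ price β o
    exchange x {o = o} {v} ≡.refl vote≈ listed-o = begin
      price β (mate M x) + v           ≈⟨ +-congˡ vote≈ ⟨
      price β (mate M x) + vote x o    ≤⟨ dual x o (option o listed-o) ⟩
      price β o + vote x (mate M x)    ≈⟨ +-congˡ (vote-self x) ⟩
      price β o + 0#                   ≈⟨ +-identityʳ _ ⟩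
      price β o                        ∎
      where
      option : ∀ o → (∀ p → o ≡ just p → p ∈ list x) → Votes.Option I M x o
      option nothing  _ = lift tt
      option (just p) h = h p ≡.refl

  β-better : ∀ {x p q} → edges M x p → q ∈ list x → rank x q ℕ.< rank x p → β p + w x ≤ β q
  β-better {x} Mxp q∈ q<p = exchange x Mxp (vote-for Mxp q<p (ℕ.<-asym q<p)) λ { _ ≡.refl → q∈ }

  β-tied : ∀ {x p q} → edges M x p → q ∈ list x → rank x q ≡ rank x p → β p ≤ β q
  β-tied {x} Mxp q∈ q≡p = ≤-trans (≤-reflexive (sym (+-identityʳ _)))
    (exchange x Mxp (vote-abstain Mxp (ℕ.<-irrefl q≡p) (ℕ.<-irrefl (≡.sym q≡p))) λ { _ ≡.refl → q∈ })

  β≤w : ∀ {x p} → edges M x p → β p ≤ w x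
  β≤w {x} Mxp = ≤-trans (-≤⇒≤+ (exchange x {o = nothing} Mxp (vote-against Mxp (λ ()) tt) λ _ ()))
                  (≤-reflexive (+-identityˡ _))

  -- An unmatched `x` would force the price of her last resort job up to `w x`; but nobody else
  -- lists that job, so it is idle and costs nothing.
  matched : ∀ x → ∃[ p ] edges M x p
  matched x with mate M x in eq
  ... | just p  = p , ≡.refl
  ... | nothing = contradiction (<-≤-trans (weight-pos (category x)) w≤β)
      (idle (lastResort x) λ y eq′ → free (≡.subst (λ z → edges M z (lastResort x))
        (lastResort-own x y (listed M y _ eq′)) eq′))
    where
    free : ¬ edges M x (lastResort x)
    free eq′ with ≡.trans (≡.sym eq) eq′
    ... | ()
    w≤β : w x ≤ β (lastResort x)
    w≤β = ≤-trans (≤-reflexive (sym (+-identityˡ _)))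
      (exchange x eq (vote-for eq tt λ ()) λ { _ ≡.refl → lastResort-listed x })

  taken : ∀ {p} → 0# < β p → ∃[ y ] edges M y p
  taken {p} 0<β with matched? M (inj₂ p)
  ... | yes m = m
  ... | no ¬m = contradiction 0<β (idle p λ x eq → ¬m (x , eq))

  stage : Category → Matching
  stage i = restrict (Gᶜ? i) M

  stage⁻ : ∀ i {x p} → edges (stage i) x p → edges M x p × Gᶜ i x p
  stage⁻ i = proj₁ (restrict-edges (Gᶜ? i) M)

  StageMaximum : Category → Set
  StageMaximum i = IsMaximum (Gᶜ i) (stage i)

  -- No job that is non-critical in the first j graphs costs more than what the
  -- applicants outside those graphs can pay.
  Cheap : ℕ → Set ℓ₂
  Cheap j = ∀ q → NonCriticalUpTo j q → 0# < β q → ¬ (∀ y → j ℕ.≤ toℕ (category y) → w y < β q)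

  below-weight : ∀ {x q} → Cheap (toℕ (category x)) → NonCriticalUpTo (toℕ (category x)) q → β q ≤ w x
  below-weight {x} {q} cheap nc w<β = cheap q nc (<-trans (weight-pos (category x)) w<β)
    λ y x≤y → ≤-<-trans (weight-≤ x≤y) w<β

  module _ {x p} (maximum : ∀ i → toℕ i ℕ.< toℕ (category x) → StageMaximum i)
           (Mxp : edges M x p) (¬first : ¬ First x p) where

    -- If `p` were ranked as high as a first job, it would be critical in an earlier graph, and the
    -- maximum matching there, a part of `M`, would give it to an applicant of an earlier category
    -- than `x`.
    below-first : ∀ {q} → First x q → rank x q ℕ.< rank x p
    below-first fq = ℕ.≰⇒> λ p≤q →
      let i , i<c , _ , crit = higher⇒newlyCritical fq (listed M x p Mxp) p≤q ¬first
          y , Ny             = crit (stage i) (maximum i i<c)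
          My , yp            = stage⁻ i Ny
      in ℕ.<⇒≱ i<c (≡.subst (λ z → toℕ (category z) ℕ.≤ toℕ i) (injective M y x p My Mxp)
           (proj₁ (Gᶜ⇒First i yp)))

    -- A first job of `x` costs at least `β p + w x` by `below-first` and at most `w x` by
    -- `below-weight`.
    non-first-free : Cheap (toℕ (category x)) → β p ≤ 0#
    non-first-free cheap 0<β = let q , fq@(q∈ , nc , _) = first-exists x in
      below-weight cheap nc (<-≤-trans
        (<-respˡ-≈ (+-identityˡ _) (+-monoˡ-< (w x) 0<β)) (β-better Mxp q∈ (below-first fq)))

  module _ (i : Category) (maximum : ∀ j → toℕ j ℕ.< toℕ i → StageMaximum j)
           (cheap : ∀ j → j ℕ.≤ toℕ i → Cheap j) where
    private
      maximum′ : ∀ {x} → toℕ (category x) ℕ.≤ toℕ i → ∀ j → toℕ j ℕ.< toℕ (category x) → StageMaximum j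
      maximum′ c≤i j j<c = maximum j (ℕ.<-≤-trans j<c c≤i)

    stage-exposed : ∀ {x q} → mate (stage i) x ≡ nothing → Gᶜ i x q → w x ≤ β q
    stage-exposed {x} {q} free xq =
      let p , Mxp   = matched x
          c≤i , fq  = Gᶜ⇒First i xq
      in ≤-trans (x≤y+x (nonneg p)) (β-better Mxp (proj₁ fq)
           (below-first (maximum′ c≤i) Mxp (unassigned Mxp c≤i) fq))
      where
      unassigned : ∀ {p} → edges M x p → toℕ (category x) ℕ.≤ toℕ i → ¬ First x p
      unassigned Mxp c≤i fp with ≡.trans (≡.sym free) (restrict⁺ (Gᶜ? i) M Mxp (First⇒Gᶜ i c≤i fp))
      ... | ()

    -- Whoever holds `p` is not of a later category, which cannot pay `b`, and does not hold it as a
    -- non-first job, which would be free. So the edge belongs to the stage.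
    stage-busy : ∀ {p b} → 0# < b → (∀ y → toℕ i ℕ.< toℕ (category y) → w y < b) → b ≤ β p →
                 ∃[ x ] edges (stage i) x p
    stage-busy {p} {b} 0<b beyond b≤β with taken (<-≤-trans 0<b b≤β)
    ... | y , Myp with toℕ (category y) ℕ.≤? toℕ i
    ...   | no  c≰i = contradiction (beyond y (ℕ.≰⇒> c≰i)) (≤-trans b≤β (β≤w Myp))
    ...   | yes c≤i with first? y p
    ...     | yes fp = y , restrict⁺ (Gᶜ? i) M Myp (First⇒Gᶜ i c≤i fp)
    ...     | no ¬fp = contradiction (<-≤-trans 0<b b≤β)
                         (non-first-free (maximum′ c≤i) Myp ¬fp (cheap _ c≤i))

    stage-closed : ∀ {x p q b} → edges (stage i) x p → b ≤ β p → Gᶜ i x q → b ≤ β q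
    stage-closed Nxp b≤β xq =
      let Mxp , xp = stage⁻ i Nxp
          _ , fp   = Gᶜ⇒First i xp
          _ , fq   = Gᶜ⇒First i xq
      in ≤-trans b≤β (β-tied Mxp (proj₁ fq) (First-rank fq fp))

    -- The bound `b` exceeds all weights outside the stage, so jobs at this price are held along
    -- stage edges. It exceeds no weight inside, so all first jobs of an exposed applicant reach
    -- this price.
    threshold-cover : ∀ {b} → 0# < b → (∀ y → toℕ i ℕ.< toℕ (category y) → w y < b) →
                      (∀ x → toℕ (category x) ℕ.≤ toℕ i → b ≤ w x) →
                      Cover (Gᶜ i) (stage i) (λ p → b ≤ β p)
    threshold-cover {b} 0<b beyond within = record
      { decide  = λ p → ¬? (β p <? b)
      ; busy    = stage-busy 0<b beyond
      ; closed  = stage-closed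
      ; exposed = λ free xq → ≤-trans (within _ (proj₁ (Gᶜ⇒First i xq))) (stage-exposed free xq)
      }

    weight-cover : Cover (Gᶜ i) (stage i) (λ p → weight i ≤ β p)
    weight-cover = threshold-cover (weight-pos i) (λ y → weight-decreasing i (category y)) λ x → weight-≤

    stage-maximum : StageMaximum i
    stage-maximum = cover⇒maximum (λ e → proj₂ (stage⁻ i e)) weight-cover

    -- The price of a violating `q`, taken as the threshold, gives a cover through `q`, which makes
    -- `q` critical in the graph just added.
    stage-cheap : Cheap (ℕ.suc (toℕ i))
    stage-cheap q nc 0<β beyond = nonCritical-< i (ℕ.n<1+n _) nc
      (cover-critical-job stage-maximum (threshold-cover 0<β beyond λ x c≤i →
        below-weight (cheap _ c≤i) (nonCritical-≤ (ℕ.m≤n⇒m≤1+n c≤i) nc)) ≤-refl)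

  -- One induction for both statements, since each of them at a stage draws on both at the earlier
  -- stages. Initially, a violating `q` has a holder, who pays at most her own weight.
  invariant : ∀ j → j ℕ.≤ #categories →
              (∀ i → toℕ i ℕ.< j → StageMaximum i) × (∀ k → k ℕ.≤ j → Cheap k)
  invariant ℕ.zero _ = (λ _ ()) , λ { _ z≤n q _ 0<β beyond →
    let y , Myq = taken 0<β in contradiction (beyond y z≤n) (β≤w Myq) }
  invariant (ℕ.suc j) j<K = maximum′ , cheap′
    where
    i₀ : Category
    i₀ = fromℕ< j<K
    i₀≡j : toℕ i₀ ≡ j
    i₀≡j = toℕ-fromℕ< j<K
    maximum = proj₁ (invariant j (ℕ.<⇒≤ j<K))
    cheap   = proj₂ (invariant j (ℕ.<⇒≤ j<K))
    maximum₀ : ∀ i → toℕ i ℕ.< toℕ i₀ → StageMaximum i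
    maximum₀ i i<i₀ = maximum i (≡.subst (toℕ i ℕ.<_) i₀≡j i<i₀)
    cheap₀ : ∀ k → k ℕ.≤ toℕ i₀ → Cheap k
    cheap₀ k k≤i₀ = cheap k (≡.subst (k ℕ.≤_) i₀≡j k≤i₀)
    maximum′ : ∀ i → toℕ i ℕ.< ℕ.suc j → StageMaximum i
    maximum′ i i<1+j with ℕ.m≤n⇒m<n∨m≡n (ℕ.≤-pred i<1+j)
    ... | inj₁ i<j = maximum i i<j
    ... | inj₂ i≡j = ≡.subst StageMaximum (toℕ-injective (≡.trans i₀≡j (≡.sym i≡j)))
                       (stage-maximum i₀ maximum₀ cheap₀)
    cheap′ : ∀ k → k ℕ.≤ ℕ.suc j → Cheap k
    cheap′ k k≤1+j with ℕ.m≤n⇒m<n∨m≡n k≤1+j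
    ... | inj₁ k<1+j = cheap k (ℕ.≤-pred k<1+j)
    ... | inj₂ ≡.refl = ≡.subst (Cheap ∘ ℕ.suc) i₀≡j (stage-cheap i₀ maximum₀ cheap₀)

  maximum : ∀ i → StageMaximum i
  maximum i = proj₁ (invariant #categories ℕ.≤-refl) i (toℕ<n i)

  cheap : ∀ j → j ℕ.≤ #categories → Cheap j
  cheap = proj₂ (invariant #categories ℕ.≤-refl)

  cover : ∀ i → Cover (Gᶜ i) (stage i) (λ p → weight i ≤ β p)
  cover i = weight-cover i (λ j _ → maximum j) (λ j j≤i → cheap j (ℕ.≤-trans j≤i (ℕ.<⇒≤ (toℕ<n i))))

  β≤weight : ∀ i {p} → NewlyCritical i p → β p ≤ weight i
  β≤weight i {p} (nc , _) w<β = cheap (toℕ i) (ℕ.<⇒≤ (toℕ<n i)) p nc (<-trans (weight-pos i) w<β)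
    λ y i≤y → ≤-<-trans (weight-≤ i≤y) w<β

  -- The jobs costing at least `β p`, cut down to a cover through `p`, form a cover for `M` and
  -- hence for the chosen matching, where it follows the path to the mate of `x`. Since `x` is
  -- critical, her mate in `M` is a neighbour in the same graph, and `closed` carries the bound over
  -- to it.
  β-path : ∀ i {p x} → NewlyCritical i p → Reaches i p x →
           ∃[ q ] edges M x q × First x q × β p ≤ β q
  β-path i {p} {x} new@(_ , crit) (x-crit , _ , _ , path , _) =
    let Q , Q-cover , Qp =
          Critical⇒Cover.critical-job⇒cover (Gᶜ? i) (G-listed _) {stage i} (maximum i) crit
        cover′ : Cover (Gᶜ i) (chosen i p) (λ q → β p ≤ β q × Q q)
        cover′ = cover-transfer within
          (cover-∩ {M = stage i} (λ q → ¬? (β q <? β p))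
            (λ Nxp b≤β _ xq → stage-closed i maximum′ cheap′ Nxp b≤β xq)
            (λ free xq → ≤-trans (≤-trans (β≤weight i new) (weight-≤ (proj₁ (Gᶜ⇒First i xq))))
                           (stage-exposed i maximum′ cheap′ free xq))
            within Q-cover)
          {chosen i p} (chosen-maximum i p)
        q′ , Cq′ , in-cover  = altPath-cover cover′ path (≤-refl , Qp)
        q , Nq               = x-crit (stage i) (maximum i)
        Mq , xq              = stage⁻ i Nq
    in q , Mq , proj₂ (Gᶜ⇒First i xq) , proj₁ (Cover.closed cover′ Cq′ in-cover xq)
    where
    open Run r using (chosen; chosen-maximum)
    within : edges (stage i) ⇒ Gᶜ i
    within e = proj₂ (stage⁻ i e)
    maximum′ : ∀ j → toℕ j ℕ.< toℕ i → StageMaximum j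
    maximum′ j _ = maximum j
    cheap′ : ∀ j → j ℕ.≤ toℕ i → Cheap j
    cheap′ j j≤i = cheap j (ℕ.≤-trans j≤i (ℕ.<⇒≤ (toℕ<n i)))

  -- The induction is on the stage: a job `q` that realises the label of `p` became critical earlier
  -- than `p`.
  β≤label : ∀ i {p} → NewlyCritical i p → β p ≤ label p
  β≤label i = go i (ℕ.<-wellFounded (toℕ i))
    where
    go : ∀ i → Acc ℕ._<_ (toℕ i) → ∀ {p} → NewlyCritical i p → β p ≤ label p
    go i (acc rec) {p} new with label-attained i new
    ... | weight-attained h = ≤-trans (β≤weight i new) h
    ... | better-attained {x} {q} reach b@(q∈ , above) h =
      let q′ , Mq′ , fq′ , β≤β = β-path i new reach
          j , j<c , newq       = better-critical b
          j<i                  = ℕ.<-≤-trans j<c (critical⇒category i p (proj₁ reach))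
      in +-cancelʳ-≤ (w x) (begin
        β p + w x       ≤⟨ +-monoˡ-≤ (w x) β≤β ⟩
        β q′ + w x      ≤⟨ β-better Mq′ q∈ (above q′ fq′) ⟩
        β q             ≤⟨ go j (rec j<i) newq ⟩
        label q         ≤⟨ h ⟩
        label p + w x   ∎)
    ... | tied-attained {x} {q} reach t@(q∈ , _ , same) h =
      let q′ , Mq′ , fq′ , β≤β = β-path i new reach
          j , j<c , newq       = tied-critical t
          j<i                  = ℕ.<-≤-trans j<c (critical⇒category i p (proj₁ reach))
      in begin
        β p       ≤⟨ β≤β ⟩
        β q′      ≤⟨ β-tied Mq′ q∈ (same q′ fq′) ⟩
        β q       ≤⟨ go j (rec j<i) newq ⟩
        label q   ≤⟨ h ⟩
        label p   ∎

  module _ {x p} (Mxp : edges M x p) (¬first : ¬ First x p) where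

    non-first⇒second : Second x p
    non-first⇒second = ¬x-crit , listed M x p Mxp , nc , p-min
      where
      i₀ = category x
      not-in-stage : ∀ i → ¬ (∃[ y ] edges (stage i) y p)
      not-in-stage i (y , Ny) = let My , yp = stage⁻ i Ny in
        ¬first (≡.subst (λ z → First z p) (injective M y x p My Mxp) (proj₂ (Gᶜ⇒First i yp)))
      ¬x-crit : ¬ Critical (Gᶜ i₀) (inj₁ x)
      ¬x-crit crit =
        let q , Nq   = crit (stage i₀) (maximum i₀)
            Mq , xq  = stage⁻ i₀ Nq
        in ¬first (≡.subst (First x) (just-injective (≡.trans (≡.sym Mq) Mxp)) (proj₂ (Gᶜ⇒First i₀ xq)))
      nc : NonCriticalUpTo (ℕ.suc (toℕ i₀)) p
      nc = decidable-stable (nonCritical? _ p) λ ¬nc →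
        let i , _ , _ , crit = newlyCritical _ (toℕ<n i₀) ¬nc in not-in-stage i (crit (stage i) (maximum i))
      p-min : ∀ q → q ∈ list x → NonCriticalUpTo (ℕ.suc (toℕ i₀)) q → rank x p ℕ.≤ rank x q
      -- A higher `q` would cost at least `w x`, more than any later category can pay, contrary to
      -- `cheap`.
      p-min q q∈ ncq = ℕ.≮⇒≥ λ q<p →
        let w≤β = ≤-trans (x≤y+x (nonneg p)) (β-better Mxp q∈ q<p) in
        cheap (ℕ.suc (toℕ i₀)) (toℕ<n i₀) q ncq (<-≤-trans (weight-pos i₀) w≤β)
          λ y c<y → <-≤-trans (weight-decreasing i₀ (category y) c<y) w≤β

  first-or-second : ∀ {x p} → edges M x p → First x p ⊎ Second x p
  first-or-second {x} {p} Mxp with first? x p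
  ... | yes fp = inj₁ fp
  ... | no ¬fp = inj₂ (non-first⇒second Mxp ¬fp)

  wellFormed : WellFormed M
  wellFormed = (λ i → stage i , restrict-edges (Gᶜ? i) M , maximum i) ,
               λ x → let p , Mxp = matched x in p , Mxp , first-or-second Mxp

  unpruned : ∀ {x p} → edges M x p → ¬ Pruned r x p
  unpruned {x} {p} Mxp (first i 0<i c≤i ¬crit below fp) = [ by-better , by-tied ]′ below
    where
    weight≤β : weight i ≤ β p
    -- If `p` were outside the weight cover, the stage edge to `p` would make `x` critical.
    weight≤β β<weight = ¬crit (cover-critical-applicant {M = stage i} (maximum i) (cover i)
      (restrict⁺ (Gᶜ? i) M Mxp (First⇒Gᶜ i c≤i fp)) (λ weight≤ → weight≤ β<weight))
    by-better : ¬ (IsLambdaMin (Run.labels r (toℕ i)) x (First x) Below (w x + weight i))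
    by-better (v , (_ , inj₁ (q , q∈ , above , v≡)) , v<)
      with ≡.subst (_<⁺ [ w x + weight i ]) (≡.trans v≡ (better-label (q∈ , above) i c≤i)) v<
    ... | [ label< ] = let j , _ , newq = better-critical (q∈ , above) in
      contradiction label< (begin
        w x + weight i   ≤⟨ +-monoʳ-≤ (w x) weight≤β ⟩
        w x + β p        ≈⟨ +-comm (w x) (β p) ⟩
        β p + w x        ≤⟨ β-better Mxp q∈ (above p fp) ⟩
        β q              ≤⟨ β≤label j newq ⟩
        label q          ∎)
    by-better (_ , (_ , inj₂ ≡.refl) , ())
    by-tied : ¬ (IsLambdaEquiv (Run.labels r (toℕ i)) x Below weight i)
    by-tied (v , (_ , inj₁ (q , q∈ , ¬fq , same , v≡)) , v<)
      with ≡.subst (_<⁺ [ weight i ]) (≡.trans v≡ (tied-label (q∈ , ¬fq , same) i c≤i)) v<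
    ... | [ label< ] = let j , _ , newq = tied-critical (q∈ , ¬fq , same) in
      contradiction label< (begin
        weight i   ≤⟨ weight≤β ⟩
        β p        ≤⟨ β-tied Mxp q∈ (same p fp) ⟩
        β q        ≤⟨ β≤label j newq ⟩
        label q    ∎)
    by-tied (_ , (_ , inj₂ ≡.refl) , ())
  unpruned Mxp (second (_ , (_ , inj₂ ≡.refl) , ()) _)
  unpruned {x} {p} Mxp (second (v , (_ , inj₁ (q , q∈ , above , v≡)) , v<) sp@(_ , p∈ , nc , p-min))
    with newlyCritical _ (toℕ<n (category x)) (λ ncq → ℕ.<⇒≱ (above p sp) (p-min q q∈ ncq))
  ... | j , _ , newq
    with ≡.subst (_<⁺ [ w x ]) (≡.trans v≡ (labelled j q newq _ (toℕ<n j) ℕ.≤-refl)) v<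
  ...   | [ label<w ] = contradiction label<w (begin
    w x         ≤⟨ x≤y+x (nonneg p) ⟩
    β p + w x   ≤⟨ β-better Mxp q∈ (above p sp) ⟩
    β q         ≤⟨ β≤label j newq ⟩
    label q     ∎)

  wellFormed×unpruned : WellFormed M × (edges M ⇒ PrunedGraph r)
  wellFormed×unpruned = wellFormed , λ Mxp → first-or-second Mxp , unpruned Mxp

-- The labels as prices

¬¬-∀ : ∀ {a n} {P : Fin n → Set a} → (∀ i → ¬ ¬ P i) → ¬ ¬ (∀ i → P i)
¬¬-∀ {n = ℕ.zero}  h k = k λ ()
¬¬-∀ {n = ℕ.suc n} h k = h zero λ P0 → ¬¬-∀ (h ∘ suc) λ Ps → k λ { zero → P0 ; (suc i) → Ps i }

-- Existence of alternating paths from covers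

module AlternatingPaths {c ℓ₁ ℓ₂} {W : OrderedAbelianGroup c ℓ₁ ℓ₂} (I : Instance W) where
  open Instance I
  open PopularMatching I
  open Covers I

  module _ {H : Graph 0ℓ} {N : Matching} {z : Applicant} where

    path-suffix : ∀ {p q ps xs} → AltPath H N z p ps xs → Unique ps → Unique xs → q ∈ˡ ps →
                  SimpleAltPath H N q z
    path-suffix path@(end _ _)          up ux (here ≡.refl) = _ , _ , path , up , ux
    path-suffix path@(step _ _ _ _ _)   up ux (here ≡.refl) = _ , _ , path , up , ux
    path-suffix (step _ _ _ _ path) (_ ∷ up) (_ ∷ ux) (there q∈) = path-suffix path up ux q∈

    path-mates : ∀ {p x ps xs} → AltPath H N z p ps xs → x ∈ˡ xs → ∃[ q ] edges N x q × q ∈ˡ ps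
    path-mates (end _ Nzp)          (here ≡.refl) = _ , Nzp , here ≡.refl
    path-mates (step _ Nxp _ _ _)   (here ≡.refl) = _ , Nxp , here ≡.refl
    path-mates (step _ _ _ _ path)  (there x∈)    =
      let q , Nxq , q∈ = path-mates path x∈ in q , Nxq , there q∈

    -- If `p` has been visited, a suffix of the path serves. Otherwise `x` is new as well, because a
    -- visit to `x` includes her mate `p`.
    path-extend : ∀ {x p q} → H x p → edges N x p → H x q → SimpleAltPath H N q z → SimpleAltPath H N p z
    path-extend {x} {p} {q} xp Nxp xq simple@(ps , xs , path , up , ux) with mem? _≟_ p ps
    ... | yes p∈ = path-suffix path up ux p∈
    ... | no  p∉ = p ∷ ps , x ∷ xs , step xp Nxp xq ¬Nxq path , ¬Any⇒All¬ _ p∉ ∷ up , ¬Any⇒All¬ _ x∉ ∷ ux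
      where
      head-visited : ∀ {q ps xs} → AltPath H N z q ps xs → q ∈ˡ ps
      head-visited (end _ _)        = here ≡.refl
      head-visited (step _ _ _ _ _) = here ≡.refl
      same : ∀ {q} → edges N x q → q ∈ˡ ps → p ∈ˡ ps
      same Nxq = ≡.subst (_∈ˡ ps) (just-injective (≡.trans (≡.sym Nxq) Nxp))
      ¬Nxq : ¬ edges N x q
      ¬Nxq Nxq = p∉ (same Nxq (head-visited path))
      x∉ : x ∉ˡ xs
      x∉ x∈ = let _ , Nxq , q∈ = path-mates path x∈ in p∉ (same Nxq q∈)

    -- The jobs without a path to z, cut down to a cover through p and enlarged by a
    -- cover that avoids the mate of z, would form a cover separating p from z.
    path-exists : (∀ x p → Dec (H x p)) → (∀ {x p} → H x p → p ∈ list x) → IsMaximum H N →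
                  ∀ {p} → Critical H (inj₂ p) → Critical H (inj₁ z) →
                  (∀ (Z : Pred Job 0ℓ) → Cover H N Z → Z p → ∀ {q} → edges N z q → Z q) →
                  ¬ ¬ SimpleAltPath H N p z
    path-exists H? H⊆list N-max {p} p-crit z-crit separate ¬path =
      -- The cover `Z` must be decidable, which takes a decision about paths from every job. In a
      -- refutation this may be assumed, as there are finitely many jobs.
      ¬¬-∀ {P = λ q → Dec (SimpleAltPath H N q z)} (λ q → ¬¬-excluded-middle) refute
      where
      open Critical⇒Cover H? H⊆list {N} N-max
      Q₁ = proj₁ (critical-job⇒cover p-crit)
      Q₀ = proj₁ (critical-applicant⇒cover z-crit)
      module Q₁ = Cover (proj₁ (proj₂ (critical-job⇒cover p-crit)))
      module Q₀ = Cover (proj₁ (proj₂ (critical-applicant⇒cover z-crit)))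
      Z : Pred Job 0ℓ
      Z q = (¬ SimpleAltPath H N q z × Q₁ q) ⊎ Q₀ q
      refute : ¬ (∀ q → Dec (SimpleAltPath H N q z))
      refute path? with z-crit N N-max
      ... | m , Nzm with separate Z cover (inj₁ (¬path , proj₂ (proj₂ (critical-job⇒cover p-crit)))) Nzm
        where
        closed′ : ∀ {x q q′} → edges N x q → Z q → H x q′ → Z q′
        closed′ Nxq (inj₂ Q₀q)          xq′ = inj₂ (Q₀.closed Nxq Q₀q xq′)
        closed′ {q′ = q′} Nxq (inj₁ (¬pathq , Q₁q)) xq′ with path? q′
        ... | yes path = contradiction (path-extend (proj₁ N-max Nxq) Nxq xq′ path) ¬pathq
        ... | no ¬path = inj₁ (¬path , Q₁.closed Nxq Q₁q xq′)
        cover : Cover H N Z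
        cover = record
          { decide  = λ q → (¬? (path? q) ×-dec Q₁.decide q) ⊎-dec Q₀.decide q
          ; busy    = [ Q₁.busy ∘ proj₂ , Q₀.busy ]′
          ; closed  = closed′
          ; exposed = λ free xq → inj₂ (Q₀.exposed free xq)
          }
      ...   | inj₁ (¬pathm , _) = ¬pathm (_ , _ , end (proj₁ N-max Nzm) Nzm , All.[] ∷ [] , All.[] ∷ [])
      ...   | inj₂ Q₀m          = proj₂ (proj₂ (critical-applicant⇒cover z-crit)) Nzm Q₀m

module ToPopular {c ℓ₁ ℓ₂} {W : OrderedAbelianGroup c ℓ₁ ℓ₂} (I : Instance W)
                 (r : PopularMatching.Run I) (¬stop : ¬ PopularMatching.ReturnsNoPopularMatching I r)
                 (M : PopularMatching.Matching I) (wellFormed : PopularMatching.WellFormed I M)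
                 (M⊆G′ : PopularMatching.edges I M ⇒ PopularMatching.PrunedGraph I r) where
  open OrderedAbelianGroup W
  open Instance I
  open PopularMatching I
  open Covers I
  open Stages I
  open Labels r
  open AlternatingPaths I
  open OrderedGroup W
  open Votes I M using (vote; vote-for; vote-against; vote-abstain; vote-self; price; Feasible; Option)
  open Run r using (chosen; chosen-maximum)
  open ≤-Reasoning

  stage : Category → Matching
  stage i = proj₁ (proj₁ wellFormed i)

  stage⁻ : ∀ i {x p} → edges (stage i) x p → edges M x p × Gᶜ i x p
  stage⁻ i = proj₁ (proj₁ (proj₂ (proj₁ wellFormed i)))

  stage⁺ : ∀ i {x p} → edges M x p → Gᶜ i x p → edges (stage i) x p
  stage⁺ i Mxp xp = proj₂ (proj₁ (proj₂ (proj₁ wellFormed i))) (Mxp , xp)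

  maximum : ∀ i → IsMaximum (Gᶜ i) (stage i)
  maximum i = proj₂ (proj₂ (proj₁ wellFormed i))

  within : ∀ i → edges (stage i) ⇒ Gᶜ i
  within i e = proj₂ (stage⁻ i e)

  critical-assigned : ∀ i {x p} → Critical (Gᶜ i) (inj₂ p) → edges M x p → Gᶜ i x p
  critical-assigned i {x} {p} crit Mxp =
    let y , Ny  = crit (stage i) (maximum i)
        My , yp = stage⁻ i Ny
    in ≡.subst (λ z → Gᶜ i z p) (injective M y x p My Mxp) yp

  job-cases : ∀ p → NonCriticalUpTo #categories p ⊎ ∃[ i ] NewlyCritical i p
  job-cases p with nonCritical? #categories p
  ... | yes nc = inj₁ nc
  ... | no ¬nc = let i , _ , new = newlyCritical #categories ℕ.≤-refl ¬nc in inj₂ (i , new)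

  -- The path is one for the chosen matching, whereas `p` is the mate of `x` in `M`. A cover for the
  -- chosen matching through `p` is one for the stage of `M`, so it contains all neighbours of `x`,
  -- among them her chosen mate.
  reaches-own : ∀ i {x p} → NewlyCritical i p → edges M x p → Critical (Gᶜ i) (inj₁ x) → ¬ ¬ Reaches i p x
  reaches-own i {x} {p} (_ , p-crit) Mxp x-crit ¬reaches =
    path-exists (Gᶜ? i) (G-listed _) (chosen-maximum i p) p-crit x-crit separate
      λ path → ¬reaches (x-crit , path)
    where
    separate : ∀ (Z : Pred Job 0ℓ) → Cover (Gᶜ i) (chosen i p) Z → Z p →
               ∀ {q} → edges (chosen i p) x q → Z q
    separate Z cover Zp Nxq = Cover.closed
      (cover-transfer (proj₁ (chosen-maximum i p)) cover {stage i} (maximum i))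
      (stage⁺ i Mxp (critical-assigned i p-crit Mxp)) Zp (proj₁ (chosen-maximum i p) Nxq)

  -- A cover of the larger graph through `p` contains `q`. Cut down to the smaller graph it follows
  -- the given path to `y`, and back in the larger graph it contains the chosen mate of `y`; so no
  -- cover separates `p` from `y`.
  reaches-chain : ∀ {i j x p q y} → toℕ j ℕ.≤ toℕ i → NewlyCritical i p → NewlyCritical j q →
                  edges M x p → Gᶜ i x q → Reaches j q y → Critical (Gᶜ i) (inj₁ y) → ¬ ¬ Reaches i p y
  reaches-chain {i} {j} {x} {p} {q} {y} j≤i (_ , p-crit) (_ , q-crit) Mxp xq
                (y-critⱼ , _ , _ , path , _) y-crit ¬reaches =
    path-exists (Gᶜ? i) (G-listed _) (chosen-maximum i p) p-crit y-crit separate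
      λ path → ¬reaches (y-crit , path)
    where
    widen : ∀ {x p} → Gᶜ j x p → Gᶜ i x p
    widen xp = let c≤j , fp = Gᶜ⇒First j xp in First⇒Gᶜ i (ℕ.≤-trans c≤j j≤i) fp
    separate : ∀ (Z : Pred Job 0ℓ) → Cover (Gᶜ i) (chosen i p) Z → Z p →
               ∀ {k} → edges (chosen i p) y k → Z k
    separate Z cover Zp Nyk =
      let Q , Q-cover , Qq =
            Critical⇒Cover.critical-job⇒cover (Gᶜ? j) (G-listed _) {stage j} (maximum j) q-crit
          coverⱼ : Cover (Gᶜ j) (chosen j q) (λ k → Z k × Q k)
          coverⱼ = cover-transfer (within j)
            (cover-∩ {M = stage j} decide
              (λ Nxp Zp xp xq → closed (stage⁺ i (proj₁ (stage⁻ j Nxp)) (widen xp)) Zp (widen xq))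
              (λ free xq → exposed (still-exposed free (proj₁ (Gᶜ⇒First j xq))) (widen xq))
              (within j) Q-cover)
            {chosen j q} (chosen-maximum j q)
          _ , Cm′ , in-cover = altPath-cover coverⱼ path
            (closed (stage⁺ i Mxp (critical-assigned i p-crit Mxp)) Zp xq , Qq)
          m , Nym            = y-critⱼ (stage j) (maximum j)
          Mym , ym           = stage⁻ j Nym
          Zm , _             = Cover.closed coverⱼ Cm′ in-cover ym
      in closed (stage⁺ i Mym (widen ym)) Zm (proj₁ (chosen-maximum i p) Nyk)
      where
      open Cover (cover-transfer (proj₁ (chosen-maximum i p)) cover {stage i} (maximum i))
      still-exposed : ∀ {x} → mate (stage j) x ≡ nothing → toℕ (category x) ℕ.≤ toℕ j →
                      mate (stage i) x ≡ nothing
      still-exposed {x} free c≤j with mate (stage i) x in eq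
      ... | nothing = ≡.refl
      ... | just m  with stage⁻ i eq
      ...   | Mxm , xm with ≡.trans (≡.sym free) (stage⁺ j Mxm (First⇒Gᶜ j c≤j (proj₂ (Gᶜ⇒First i xm))))
      ...     | ()

  unpruned : ∀ {x p} → edges M x p → ¬ Pruned r x p
  unpruned Mxp = proj₂ (M⊆G′ Mxp)

  -- By closure of covers `q` is critical wherever `p` is, hence newly so at some `j ≤ i`. If an
  -- applicant `y` realises the label of `q` and is critical in `Gᶜ i`, she is a candidate for `p`
  -- too by `reaches-chain`. If not, her edge in `M` escaped pruning at stage `i`, and
  -- `label p ≤ weight i` is enough.
  label-first : ∀ i {x p q} → NewlyCritical i p → edges M x p → First x q → label p ≤ label q
  label-first i {x} {p} {q} new@(_ , p-crit) Mxp fq =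
    let j , j<1+i , newq = newlyCritical (ℕ.suc (toℕ i)) (toℕ<n i) (λ (_ , ¬crit) → ¬crit q-crit)
    in compare-labels (ℕ.≤-pred j<1+i) newq (label-attained j newq)
    where
    xp : Gᶜ i x p
    xp = critical-assigned i p-crit Mxp
    xq : Gᶜ i x q
    xq = First⇒Gᶜ i (proj₁ (Gᶜ⇒First i xp)) fq
    q-crit : Critical (Gᶜ i) (inj₂ q)
    q-crit =
      let _ , Q-cover , Qp =
            Critical⇒Cover.critical-job⇒cover (Gᶜ? i) (G-listed _) {stage i} (maximum i) p-crit
      in cover-critical-job {M = stage i} (maximum i) Q-cover (Cover.closed Q-cover (stage⁺ i Mxp xp) Qp xq)
    assigned : ∀ {j y} → Critical (Gᶜ j) (inj₁ y) →
               ∃[ m ] edges M y m × toℕ (category y) ℕ.≤ toℕ j × First y m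
    assigned {j} crit = let m , Nym = crit (stage j) (maximum j)
                            Mym , ym = stage⁻ j Nym in m , Mym , Gᶜ⇒First j ym
    compare-labels : ∀ {j} → toℕ j ℕ.≤ toℕ i → NewlyCritical j q → Attained j q → label p ≤ label q
    compare-labels {j} j≤i newq (weight-attained h) =
      ≤-trans (label≤weight i new) (≤-trans (weight-≤ j≤i) h)
    compare-labels {j} j≤i newq (better-attained {y} {k} reach b h) =
      +-cancelʳ-≤ (w y) (≤-trans (bound (criticalᶜ? i (inj₁ y))) h)
      where
      bound : Dec (Critical (Gᶜ i) (inj₁ y)) → label p + w y ≤ label k
      bound (yes crit) lt = reaches-chain j≤i new newq Mxp xq reach crit λ reach′ →
        label-better i new reach′ b lt
      bound (no ¬crit) = let m , Mym , c≤j , fm = assigned (proj₁ reach) in begin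
        label p + w y    ≤⟨ +-monoˡ-≤ (w y) (label≤weight i new) ⟩
        weight i + w y   ≈⟨ +-comm (weight i) (w y) ⟩
        w y + weight i   ≤⟨ unpruned-better (unpruned Mym) fm i (ℕ.≤-trans c≤j j≤i) ¬crit b ⟩
        label k          ∎
    compare-labels {j} j≤i newq (tied-attained {y} {k} reach t h) =
      ≤-trans (bound (criticalᶜ? i (inj₁ y))) h
      where
      bound : Dec (Critical (Gᶜ i) (inj₁ y)) → label p ≤ label k
      bound (yes crit) lt = reaches-chain j≤i new newq Mxp xq reach crit λ reach′ →
        label-tied i new reach′ t lt
      bound (no ¬crit) = let m , Mym , c≤j , fm = assigned (proj₁ reach) in
        ≤-trans (label≤weight i new) (unpruned-tied (unpruned Mym) fm i (ℕ.≤-trans c≤j j≤i) ¬crit t)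

  -- The only subtraction in a label is that of `w x` from the label of a better job, which is at
  -- least `w x` because the run did not stop.
  newlyCritical-nonneg : ∀ i {p} → NewlyCritical i p → 0# ≤ label p
  newlyCritical-nonneg i = go i (ℕ.<-wellFounded (toℕ i))
    where
    go : ∀ i → Acc ℕ._<_ (toℕ i) → ∀ {p} → NewlyCritical i p → 0# ≤ label p
    go i (acc rec) {p} new with label-attained i new
    ... | weight-attained h = ≤-trans (<⇒≤ (weight-pos i)) h
    ... | better-attained {x} {q} _ b h = +-cancelʳ-≤ (w x) (begin
      0# + w x        ≈⟨ +-identityˡ (w x) ⟩
      w x             ≤⟨ unreturned-better ¬stop b ⟩
      label q         ≤⟨ h ⟩
      label p + w x   ∎)
    ... | tied-attained reach t h = let j , j<c , newq = tied-critical t in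
      ≤-trans (go j (rec (ℕ.<-≤-trans j<c (critical⇒category i p (proj₁ reach)))) newq) h

  label≤0 : ∀ {p} → NonCriticalUpTo #categories p → label p ≤ 0#
  label≤0 nc = ≤-reflexive (reflexive (label-zero _ nc))

  label-nonneg : ∀ p → 0# ≤ label p
  label-nonneg p with job-cases p
  ... | inj₁ nc        = ≤-reflexive (reflexive (≡.sym (label-zero p nc)))
  ... | inj₂ (i , new) = newlyCritical-nonneg i new

  label-idle : ∀ p → (∀ x → ¬ edges M x p) → label p ≤ 0#
  label-idle p free with job-cases p
  ... | inj₁ nc               = label≤0 nc
  ... | inj₂ (i , _ , p-crit) = let x , Nxp = p-crit (stage i) (maximum i) in
    contradiction (proj₁ (stage⁻ i Nxp)) (free x)

  module _ {x p} (Mxp : edges M x p) where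

    data Status : Set where
      non-critical : NonCriticalUpTo #categories p → Status
      critical     : ∀ i → NewlyCritical i p → toℕ (category x) ℕ.≤ toℕ i → First x p → Status

    status : Status
    status with job-cases p
    ... | inj₁ nc        = non-critical nc
    ... | inj₂ (i , new) = let c≤i , fp = Gᶜ⇒First i (critical-assigned i (proj₂ new) Mxp) in
      critical i new c≤i fp

    label≤w : label p ≤ w x
    label≤w with status
    ... | non-critical nc      = ≤-trans (label≤0 nc) (<⇒≤ (weight-pos (category x)))
    ... | critical i new c≤i _ = ≤-trans (label≤weight i new) (weight-≤ c≤i)

    w≤label : ∀ {q} → q ∈ list x → rank x q ℕ.< rank x p → w x ≤ label q
    w≤label q∈ q<p with first? x p | proj₁ (M⊆G′ Mxp)
    ... | yes fp | _       = unreturned-better ¬stop (better fp q∈ q<p)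
    ... | no ¬fp | inj₁ fp = contradiction fp ¬fp
    ... | no ¬fp | inj₂ sp = unpruned-second (unpruned Mxp) sp q∈ q<p

    -- A job that is never critical is free, and step 3 or the absence of a stop bounds `label q`.
    -- For a critical `p`, either `x` is critical and a candidate in the label of `p`, or her edge
    -- to `p` escaped pruning.
    dual-better : ∀ {q} → q ∈ list x → rank x q ℕ.< rank x p → label p + w x ≤ label q
    dual-better {q} q∈ q<p with status
    ... | non-critical nc = begin
      label p + w x   ≤⟨ +-monoˡ-≤ (w x) (label≤0 nc) ⟩
      0# + w x        ≈⟨ +-identityˡ (w x) ⟩
      w x             ≤⟨ w≤label q∈ q<p ⟩
      label q         ∎
    ... | critical i new c≤i fp = bound (criticalᶜ? i (inj₁ x))
      where
      bound : Dec (Critical (Gᶜ i) (inj₁ x)) → label p + w x ≤ label q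
      bound (yes crit) lt = reaches-own i new Mxp crit λ reach →
        label-better i new reach (better fp q∈ q<p) lt
      bound (no ¬crit) = begin
        label p + w x    ≤⟨ +-monoˡ-≤ (w x) (label≤weight i new) ⟩
        weight i + w x   ≈⟨ +-comm (weight i) (w x) ⟩
        w x + weight i   ≤⟨ unpruned-better (unpruned Mxp) fp i c≤i ¬crit (better fp q∈ q<p) ⟩
        label q          ∎

    dual-tied : ∀ {q} → q ∈ list x → rank x q ≡ rank x p → label p ≤ label q
    dual-tied {q} q∈ q≡p with status
    ... | non-critical nc = ≤-trans (label≤0 nc) (label-nonneg q)
    ... | critical i new c≤i fp with first? x q
    ...   | yes fq = label-first i new Mxp fq
    ...   | no ¬fq = bound (criticalᶜ? i (inj₁ x))
      where
      bound : Dec (Critical (Gᶜ i) (inj₁ x)) → label p ≤ label q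
      bound (yes crit) lt = reaches-own i new Mxp crit λ reach →
        label-tied i new reach (tied fp ¬fq q∈ q≡p) lt
      bound (no ¬crit) = ≤-trans (label≤weight i new)
        (unpruned-tied (unpruned Mxp) fp i c≤i ¬crit (tied fp ¬fq q∈ q≡p))

    dual-worse : ∀ o → label p - w x ≤ price label o
    dual-worse o = ≤-trans (≤+⇒-≤ (≤-trans label≤w (≤-reflexive (sym (+-identityˡ _))))) (price-nonneg o)
      where
      price-nonneg : ∀ o → 0# ≤ price label o
      price-nonneg nothing  = ≤-refl
      price-nonneg (just q) = label-nonneg q

    dual-vote : ∀ o → Option x o → label p + vote x o ≤ price label o
    dual-vote nothing _ =
      ≤-trans (≤-reflexive (+-congˡ (vote-against Mxp (λ ()) tt))) (dual-worse nothing)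
    dual-vote (just q) q∈ with ℕ.<-cmp (rank x q) (rank x p)
    ... | tri< q<p _ q≯p = ≤-trans (≤-reflexive (+-congˡ (vote-for Mxp q<p q≯p))) (dual-better q∈ q<p)
    ... | tri≈ q≮p q≡p q≯p =
      ≤-trans (≤-reflexive (trans (+-congˡ (vote-abstain Mxp q≮p q≯p)) (+-identityʳ _))) (dual-tied q∈ q≡p)
    ... | tri> q≮p _ q>p = ≤-trans (≤-reflexive (+-congˡ (vote-against Mxp q≮p q>p))) (dual-worse (just q))

  labels-feasible : Feasible (mate M) label
  labels-feasible = record { nonneg = label-nonneg ; idle = label-idle ; dual = dual }
    where
    dual : ∀ x o → Option x o → price label (mate M x) + vote x o ≤ price label o + vote x (mate M x)
    dual x o option = let p , Mxp , _ = proj₂ wellFormed x in begin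
      price label (mate M x) + vote x o   ≡⟨ ≡.cong (λ m → price label m + vote x o) Mxp ⟩
      label p + vote x o                  ≤⟨ dual-vote Mxp o option ⟩
      price label o                       ≈⟨ +-identityʳ _ ⟨
      price label o + 0#                  ≈⟨ +-congˡ (vote-self x) ⟨
      price label o + vote x (mate M x)   ∎

  popular : Popular M
  popular = Votes.prices⇒popular I M labels-feasible

theorem4 : ∀ {c ℓ₁ ℓ₂} (W : OrderedAbelianGroup c ℓ₁ ℓ₂) (I : Instance W) →
    let open PopularMatching I in
    (r : Run) → ¬ ReturnsNoPopularMatching r →
    ∀ (M : Matching) → Popular M ⇔ (WellFormed M × (edges M ⇒ PrunedGraph r))
theorem4 W I r ¬stop M = mk⇔
  (λ popular → FromPopular.wellFormed×unpruned I r M (proj₂ (Votes.popular⇒prices I M popular)))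
  (λ (wellFormed , M⊆G′) → ToPopular.popular I r ¬stop M wellFormed M⊆G′)
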